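{- Let $G$ be a finite connected graph, let $X$ be a variance-optimal function over $G$, and let $w_0, w_1, \ldots, w_k$ ($k\ge 1$) be a hair of $G$. Then the sequence of values $X(w_0), X(w_1), \ldots, X(w_k)$ is unimodular. Let $m = \min_{0\le i\le k} X(w_i)$ and $M = \max_{0\le i\le k} X(w_i)$. If $G$ has vertices $u', u''$ such that $X(u') \leq m+1$, $X(u'') \geq M-1$, and $u',u'' \notin \{w_1, \ldots, w_k\}$, then the sequence $X(w_0), X(w_1), \ldots, X(w_k)$ is monotone.
   Context: A function $X:V(G)\to\mathbb{R}$ is Lipschitz if $|X(u)-X(v)|\le d_G(u,v)$ for all vertices $u,v$, where $d_G$ is the graph distance. Such a function is treated as a random variable by placing the uniform distribution on $V(G)$. Let $c^2(G)=\max_X \operatorname{Var}(X)$, the maximum being over Lipschitz functions $X$ on $V(G)$. A function $X$ is variance-optimal if it is Lipschitz and $\operatorname{Var}(X)=c^2(G)$. $N(v)$ is the set of neighbours of $v$. A hair of $G$ is a sequence of vertices $w_0,w_1,\ldots,w_k$ such that $N(w_i)=\{w_{i-1},w_{i+1}\}$ for $1\le i\le k-1$ and $N(w_k)=\{w_{k-1}\}$. The sequence $X(w_0),\ldots,X(w_k)$ is unimodular if there is $0\le \ell\le k$ such that $X(w_i)-X(w_{i-1})=X(w_{i'})-X(w_{i'-1})$ for all $1\le i,i'\le \ell$, and $X(w_j)-X(w_{j-1})=X(w_{j'})-X(w_{j'-1})$ for all $\ell<j,j'\le k$.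
   Formalization: A hair is required to satisfy w_{i-1} ≠ w_{i+1} for 1 ≤ i ≤ k-1, so that it does not fold back at a leaf; read literally without this, the claim fails for a,b,a,b in the single-edge graph K_2. -}

module Defs where

import Level
open import Algebra.Apartness.Bundles using (HeytingField; HeytingCommutativeRing)
open import Algebra.Bundles using (CommutativeRing)
import Algebra.Definitions.RawMonoid as RawMonoidDefs
open import Data.Empty using (⊥-elim)
open import Data.Fin.Base using (Fin; zero; suc; toℕ; inject₁)
import Data.Fin.Base as Fin
import Data.Fin.Properties as Fin
open import Data.Nat.Base as ℕ using (ℕ; zero; suc; NonZero; z≤n; s≤s)
open import Data.Product.Base using (∃; _×_; _,_; proj₁; proj₂)
open import Data.Sum.Base using (_⊎_; inj₁; inj₂)
open import Data.Vec.Functional using (Vector)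
open import Function.Base using (_∘_)
open import Function.Bundles using (_⇔_; Equivalence)
open import Relation.Binary.Core using (Rel)
import Relation.Binary.Definitions as B
open import Relation.Binary.Lattice.Definitions using (Supremum)
open import Relation.Binary.PropositionalEquality.Core using (_≡_; _≢_; refl)
open import Relation.Binary.Structures using (IsStrictPartialOrder)
open import Relation.Nullary using (¬_; Dec; yes; no)
open import Relation.Nullary.Decidable using (map′; _×-dec_)
open import Relation.Unary using (Pred; _≐_; _∪_; ｛_｝)

------------------------------------------------------------------------
-- The real numbers

-- The standard library has no real numbers, so ℝ is given by its axioms:
-- a Cauchy-complete Archimedean ordered field.  Classically such a field is
-- unique up to unique isomorphism.  The axioms are the constructive ones
-- (the order is not assumed decidable), so that they also hold of ℝ built
-- from regular sequences of rationals.  Since x # y means x < y or y < x,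
-- cotransitivity of _<_ follows from that of _#_, and antisymmetry of _≤_
-- from tightness.

record RealNumbers c ℓ₁ ℓ₂ : Set (Level.suc (c Level.⊔ ℓ₁ Level.⊔ ℓ₂)) where
  field
    heytingField : HeytingField c ℓ₁ ℓ₂

  open HeytingField heytingField public renaming (zero to *-zero)

  infix  4 _<_ _≤_
  infixl 6 _⊔_ _⊓_

  field
    _<_                  : Rel Carrier ℓ₂
    isStrictPartialOrder : IsStrictPartialOrder _≈_ _<_
    #⇔<⊎>                : ∀ x y → x # y ⇔ (x < y ⊎ y < x)
    0<1                  : 0# < 1#
    +-monoˡ-<            : ∀ z {x y} → x < y → x + z < y + z
    *-positive           : ∀ {x y} → 0# < x → 0# < y → 0# < x * y

  _≤_ : Rel Carrier ℓ₂
  x ≤ y = ¬ (y < x)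

  field
    _⊔_                  : Carrier → Carrier → Carrier
    ⊔-supremum           : Supremum _≤_ _⊔_

  _⊓_ : Carrier → Carrier → Carrier
  x ⊓ y = - ((- x) ⊔ (- y))

  ∣_∣ : Carrier → Carrier
  ∣ x ∣ = x ⊔ (- x)

  open HeytingCommutativeRing heytingCommutativeRing public using (commutativeRing)
  open CommutativeRing commutativeRing public using (+-rawMonoid)
  open RawMonoidDefs +-rawMonoid public using (sum) renaming (_×_ to _·_)

  fromℕ : ℕ → Carrier
  fromℕ n = n · 1#

  Cauchy : (ℕ → Carrier) → Set (c Level.⊔ ℓ₂)
  Cauchy x = ∀ ε → 0# < ε → ∃ λ N →
    ∀ m n → N ℕ.≤ m → N ℕ.≤ n → ∣ x m - x n ∣ < ε

  _ConvergesTo_ : (ℕ → Carrier) → Carrier → Set (c Level.⊔ ℓ₂)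
  x ConvergesTo l = ∀ ε → 0# < ε → ∃ λ N →
    ∀ n → N ℕ.≤ n → ∣ x n - l ∣ < ε

  field
    archimedean          : ∀ x → ∃ λ n → x < fromℕ n
    complete             : ∀ x → Cauchy x → ∃ λ l → x ConvergesTo l

  private
    module < = IsStrictPartialOrder isStrictPartialOrder

  0<fromℕ[1+n] : ∀ n → 0# < fromℕ (suc n)
  0<fromℕ[1+n] zero    = <.<-respʳ-≈ (sym (+-identityʳ 1#)) 0<1
  0<fromℕ[1+n] (suc n) = <.trans (0<fromℕ[1+n] n)
    (<.<-respˡ-≈ (+-identityˡ (fromℕ (suc n))) (+-monoˡ-< (fromℕ (suc n)) 0<1))

  fromℕ#0 : ∀ n .{{_ : NonZero n}} → fromℕ n # 0#
  fromℕ#0 (suc n) = Equivalence.from (#⇔<⊎> (fromℕ (suc n)) 0#) (inj₂ (0<fromℕ[1+n] n))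

  -- #⇒invertible provides the inverse of x - 0#.
  inverse : ∀ {x} → x # 0# → Carrier
  inverse x#0 = proj₁ (#⇒invertible x#0)

  1/_ : ∀ n .{{_ : NonZero n}} → Carrier
  1/ n = inverse (fromℕ#0 n)

  minimum : ∀ {k} → Vector Carrier (suc k) → Carrier
  minimum {zero}  x = x zero
  minimum {suc k} x = x zero ⊓ minimum (x ∘ suc)

  maximum : ∀ {k} → Vector Carrier (suc k) → Carrier
  maximum {zero}  x = x zero
  maximum {suc k} x = x zero ⊔ maximum (x ∘ suc)

  Monotone : ∀ {k} → Vector Carrier (suc k) → Set ℓ₂
  Monotone x = (∀ {i j} → i Fin.≤ j → x i ≤ x j)
             ⊎ (∀ {i j} → i Fin.≤ j → x j ≤ x i)

  -- For i : Fin k this is the (1 + i)-th difference x₁₊ᵢ - xᵢ.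
  difference : ∀ {k} → Vector Carrier (suc k) → Fin k → Carrier
  difference x i = x (suc i) - x (inject₁ i)

  Unimodular : ∀ {k} → Vector Carrier (suc k) → Set ℓ₁
  Unimodular {k} x = ∃ λ ℓ → ℓ ℕ.≤ k
    × (∀ (i i′ : Fin k) → toℕ i ℕ.< ℓ → toℕ i′ ℕ.< ℓ →
         difference x i ≈ difference x i′)
    × (∀ (j j′ : Fin k) → ℓ ℕ.≤ toℕ j → ℓ ℕ.≤ toℕ j′ →
         difference x j ≈ difference x j′)

------------------------------------------------------------------------
-- Graphs

private
  least : ∀ {p} {P : Pred ℕ p} → (∀ n → Dec (P n)) → ∀ {n} → P n →
          ∃ λ m → P m × (∀ {j} → P j → m ℕ.≤ j)
  least P? {n} Pn with P? 0
  ... | yes P0 = 0 , P0 , λ _ → z≤n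
  least P? {zero}  Pn | no ¬P0 = ⊥-elim (¬P0 Pn)
  least P? {suc n} Pn | no ¬P0 with least (P? ∘ suc) Pn
  ... | m , Pm , m≤ = suc m , Pm ,
    λ { {zero} P0 → ⊥-elim (¬P0 P0) ; {suc j} Pj → s≤s (m≤ Pj) }

record Graph : Set₁ where
  infix 4 _~_ _~?_
  field
    order    : ℕ
    {{order≢0}} : NonZero order

  V : Set
  V = Fin order

  field
    _~_      : Rel V Level.zero
    _~?_     : B.Decidable _~_
    ~-sym    : B.Symmetric _~_
    ~-irrefl : B.Irreflexive _≡_ _~_

  N : V → Pred V Level.zero
  N v u = v ~ u

  -- Walks, indexed by their number of edges.
  data Walk : V → V → ℕ → Set where
    []  : ∀ {u} → Walk u u 0
    _∷_ : ∀ {u v w n} → u ~ v → Walk v w n → Walk u w (suc n)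

  Connected : Set
  Connected = ∀ u v → ∃ λ n → Walk u v n

  walk? : ∀ u v n → Dec (Walk u v n)
  walk? u v zero    = map′ (λ { refl → [] }) (λ { [] → refl }) (u Fin.≟ v)
  walk? u v (suc n) = map′ (λ (_ , e , p) → e ∷ p) (λ { (e ∷ p) → _ , e , p })
    (Fin.any? λ x → (u ~? x) ×-dec walk? x v n)

  -- The two vertices of N (wᵢ) are required to be distinct, as the notation
  -- { wᵢ₋₁ , wᵢ₊₁ } intends: otherwise u, v, u, v, … would be a hair of the
  -- one-edge graph.  Here i and j index consecutive edges of the hair, and
  -- w (suc i), the vertex they share, is also w (inject₁ j).
  IsHair : ∀ {k} → Vector V (suc k) → Set
  IsHair {k} w =
      (∀ (i j : Fin k) → toℕ j ≡ suc (toℕ i) →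
         w (inject₁ i) ≢ w (suc j)
       × N (w (suc i)) ≐ ｛ w (inject₁ i) ｝ ∪ ｛ w (suc j) ｝)
    × (∀ (i : Fin k) → suc (toℕ i) ≡ k →
         N (w (suc i)) ≐ ｛ w (inject₁ i) ｝)

record ConnectedGraph : Set₁ where
  field
    graph     : Graph

  open Graph graph public

  field
    connected : Connected

  shortestWalk : ∀ u v → ∃ λ d → Walk u v d × (∀ {n} → Walk u v n → d ℕ.≤ n)
  shortestWalk u v = least (walk? u v) (proj₂ (connected u v))

  d : V → V → ℕ
  d u v = proj₁ (shortestWalk u v)

------------------------------------------------------------------------
-- Lipschitz functions and their variance

module Variance {c ℓ₁ ℓ₂} (ℝ : RealNumbers c ℓ₁ ℓ₂) (G : ConnectedGraph) where
  open RealNumbers ℝ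
  open ConnectedGraph G

  Lipschitz : (V → Carrier) → Set ℓ₂
  Lipschitz X = ∀ u v → ∣ X u - X v ∣ ≤ fromℕ (d u v)

  -- Expectation with respect to the uniform distribution on V.
  𝔼 : (V → Carrier) → Carrier
  𝔼 X = 1/ order * sum X

  Var : (V → Carrier) → Carrier
  Var X = 𝔼 (λ v → (X v - 𝔼 X) * (X v - 𝔼 X))

  IsMaximumVariance : Carrier → Set (c Level.⊔ ℓ₁ Level.⊔ ℓ₂)
  IsMaximumVariance c² = (∃ λ X → Lipschitz X × Var X ≈ c²)
                       × (∀ X → Lipschitz X → Var X ≤ c²)

  VarianceOptimal : (V → Carrier) → Set (c Level.⊔ ℓ₁ Level.⊔ ℓ₂)
  VarianceOptimal X = Lipschitz X × ∃ λ c² → IsMaximumVariance c² × Var X ≈ c²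

-- The variance is a strictly convex function of X modulo constants.  Shifting
-- the values on consecutive vertices of a hair by t, which only alters the steps
-- of X at the two ends of that segment, gives
--   n (2 t S + M t²) ≤ (M t)²   with n = |V|,
-- where M is the length of the segment and S the sum of X − 𝔼 X over it.
--
-- For the tails of the hair this forces every step to be ±1, so that the hair is
-- described by a sequence of signs.  Constructively, the sign of a step is decided
-- by cotransitivity of _<_ at -1 < 1.
--
-- If the steps end with τ, then −τ on D steps, then τ on the last r steps, the
-- shifts by ±2 of the segments that start at or just after a turning vertex, taken
-- together, yield n ≤ 2D and D < r, contradicting D + r < n.
--
-- If the steps end with τ followed by −τ on b steps, two such shifts yield
-- 3n ≤ 4b + 2.  But a shortest walk from u″ to u′ has at least b − 1 vertices
-- and avoids w₁, …, wₖ, so that n ≥ k + b − 1 ≥ 2b, which is impossible.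
module Submission where

open import Defs
import Algebra.Properties.AbelianGroup
import Algebra.Properties.CommutativeMonoid.Sum
import Algebra.Properties.Ring
import Algebra.Properties.Semiring.Mult
import Algebra.Properties.Semiring.Mult.TCOptimised
import Algebra.Properties.Semiring.Sum
import Algebra.Solver.Ring
open import Algebra.Bundles using (CommutativeRing)
open import Algebra.Solver.Ring.AlmostCommutativeRing using (_-Raw-AlmostCommutative⟶_; fromCommutativeRing)
open import Data.Empty using (⊥; ⊥-elim)
open import Data.Fin.Base as Fin using (Fin; zero; suc; toℕ; inject₁; splitAt; join)
import Data.Fin.Properties as Fin
open import Data.Integer.Base as ℤ using (ℤ; +_; -[1+_]; _⊖_)
import Data.Integer.Properties as ℤ
open import Data.Maybe.Base using (Maybe; just; nothing)
open import Data.Nat.Base as ℕ using (ℕ; zero; suc; NonZero; z≤n; s≤s; _∸_)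
import Data.Nat.Properties as ℕ
open import Data.Nat.Solver using (module +-*-Solver)
open import Data.Product.Base using (∃; _×_; _,_; proj₁; proj₂)
open import Data.Sign.Base as Sign using (Sign; opposite)
import Data.Sign.Properties as Sign
open import Data.Sum.Base as Sum using (_⊎_; inj₁; inj₂; [_,_]′)
open import Data.Vec.Functional using (Vector)
open import Function.Base using (_∘_)
open import Function.Bundles using (Equivalence)
open import Relation.Binary.Definitions using (tri<; tri≈; tri>)
open import Relation.Binary.PropositionalEquality.Core as ≡ using (_≡_; _≢_)
import Relation.Binary.Reasoning.Setoid
open import Relation.Binary.Structures using (IsStrictPartialOrder)
open import Relation.Nullary using (¬_; Dec; yes; no)

-- Ring identities with integer coefficients.

-- The ring solver compares coefficients, so over an abstract ring they are
-- taken from ℤ, whose equality is decidable.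
module IntegerCoefficients {c ℓ} (R : CommutativeRing c ℓ) where
  open CommutativeRing R
  open Algebra.Properties.Semiring.Mult.TCOptimised semiring renaming (_×_ to _·_)
  open Algebra.Properties.Ring ring using (-‿distribˡ-*; -‿distribʳ-*; -0#≈0#)
  open Algebra.Properties.AbelianGroup +-abelianGroup using (⁻¹-∙-comm; ⁻¹-involutive)
  open import Relation.Binary.Reasoning.Setoid setoid

  ⟦_⟧ : ℤ → Carrier
  ⟦ + n ⟧      = n · 1#
  ⟦ -[1+ n ] ⟧ = - (suc n · 1#)

  private
    ⟦-⟧-homo : ∀ i → ⟦ ℤ.- i ⟧ ≈ - ⟦ i ⟧
    ⟦-⟧-homo (+ zero)     = sym -0#≈0#
    ⟦-⟧-homo (+ suc n)    = refl
    ⟦-⟧-homo (-[1+ n ])   = sym (⁻¹-involutive _)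

    cancel : ∀ x y z → (x + y) - (x + z) ≈ y - z
    cancel x y z = begin
      (x + y) - (x + z)       ≈⟨ +-cong (+-comm y x) (⁻¹-∙-comm x z) ⟨
      (y + x) + (- x - z)     ≈⟨ +-assoc y x (- x - z) ⟩
      y + (x + (- x - z))     ≈⟨ +-congˡ (+-assoc x (- x) (- z)) ⟨
      y + ((x - x) - z)       ≈⟨ +-congˡ (+-congʳ (-‿inverseʳ x)) ⟩
      y + (0# - z)            ≈⟨ +-congˡ (+-identityˡ (- z)) ⟩
      y - z                   ∎

    ⟦⊖⟧-homo : ∀ m n → ⟦ m ⊖ n ⟧ ≈ m · 1# - n · 1#
    ⟦⊖⟧-homo m       zero    = sym (trans (+-congˡ -0#≈0#) (+-identityʳ _))
    ⟦⊖⟧-homo zero    (suc n) = sym (+-identityˡ _)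
    ⟦⊖⟧-homo (suc m) (suc n) = begin
      ⟦ suc m ⊖ suc n ⟧                ≡⟨ ≡.cong ⟦_⟧ (ℤ.[1+m]⊖[1+n]≡m⊖n m n) ⟩
      ⟦ m ⊖ n ⟧                        ≈⟨ ⟦⊖⟧-homo m n ⟩
      m · 1# - n · 1#                  ≈⟨ cancel 1# (m · 1#) (n · 1#) ⟨
      (1# + m · 1#) - (1# + n · 1#)    ≈⟨ +-cong (1+× m 1#) (-‿cong (1+× n 1#)) ⟨
      suc m · 1# - suc n · 1#          ∎

    ⟦+⟧-homo : ∀ i j → ⟦ i ℤ.+ j ⟧ ≈ ⟦ i ⟧ + ⟦ j ⟧
    ⟦+⟧-homo (+ m)      (+ n)      = ×-homo-+ 1# m n
    ⟦+⟧-homo (+ m)      (-[1+ n ]) = ⟦⊖⟧-homo m (suc n)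
    ⟦+⟧-homo (-[1+ m ]) (+ n)      = trans (⟦⊖⟧-homo n (suc m)) (+-comm _ _)
    ⟦+⟧-homo (-[1+ m ]) (-[1+ n ]) = begin
      - (suc (suc (m ℕ.+ n)) · 1#)         ≡⟨ ≡.cong (λ k → - (suc k · 1#)) (ℕ.+-suc m n) ⟨
      - ((suc m ℕ.+ suc n) · 1#)           ≈⟨ -‿cong (×-homo-+ 1# (suc m) (suc n)) ⟩
      - (suc m · 1# + suc n · 1#)          ≈⟨ ⁻¹-∙-comm _ _ ⟨
      - (suc m · 1#) - (suc n · 1#)        ∎

    ⟦*⟧-homo-+ : ∀ m j → ⟦ + m ℤ.* j ⟧ ≈ (m · 1#) * ⟦ j ⟧
    ⟦*⟧-homo-+ m (+ n)      = begin
      ⟦ + m ℤ.* + n ⟧         ≡⟨ ≡.cong ⟦_⟧ (ℤ.pos-* m n) ⟨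
      (m ℕ.* n) · 1#          ≈⟨ ×1-homo-* m n ⟩
      (m · 1#) * (n · 1#)     ∎
    ⟦*⟧-homo-+ m (-[1+ n ]) = begin
      ⟦ + m ℤ.* -[1+ n ] ⟧           ≡⟨ ≡.cong ⟦_⟧ (ℤ.neg-distribʳ-* (+ m) (+ suc n)) ⟨
      ⟦ ℤ.- (+ m ℤ.* + suc n) ⟧      ≈⟨ ⟦-⟧-homo (+ m ℤ.* + suc n) ⟩
      - ⟦ + m ℤ.* + suc n ⟧          ≈⟨ -‿cong (⟦*⟧-homo-+ m (+ suc n)) ⟩
      - ((m · 1#) * (suc n · 1#))    ≈⟨ -‿distribʳ-* _ _ ⟩
      (m · 1#) * - (suc n · 1#)      ∎

    ⟦*⟧-homo : ∀ i j → ⟦ i ℤ.* j ⟧ ≈ ⟦ i ⟧ * ⟦ j ⟧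
    ⟦*⟧-homo (+ m)      j = ⟦*⟧-homo-+ m j
    ⟦*⟧-homo (-[1+ m ]) j = begin
      ⟦ -[1+ m ] ℤ.* j ⟧             ≡⟨ ≡.cong ⟦_⟧ (ℤ.neg-distribˡ-* (+ suc m) j) ⟨
      ⟦ ℤ.- (+ suc m ℤ.* j) ⟧        ≈⟨ ⟦-⟧-homo (+ suc m ℤ.* j) ⟩
      - ⟦ + suc m ℤ.* j ⟧            ≈⟨ -‿cong (⟦*⟧-homo-+ (suc m) j) ⟩
      - ((suc m · 1#) * ⟦ j ⟧)       ≈⟨ -‿distribˡ-* _ _ ⟩
      - (suc m · 1#) * ⟦ j ⟧         ∎

    homomorphism : ℤ.+-*-rawRing -Raw-AlmostCommutative⟶ fromCommutativeRing R
    homomorphism = record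
      { ⟦_⟧    = ⟦_⟧
      ; +-homo = ⟦+⟧-homo
      ; *-homo = ⟦*⟧-homo
      ; -‿homo = ⟦-⟧-homo
      ; 0-homo = refl
      ; 1-homo = refl
      }

    ⟦_⟧≟⟦_⟧ : ∀ i j → Maybe (⟦ i ⟧ ≈ ⟦ j ⟧)
    ⟦ i ⟧≟⟦ j ⟧ with i ℤ.≟ j
    ... | yes i≡j = just (reflexive (≡.cong ⟦_⟧ i≡j))
    ... | no  _   = nothing

  open Algebra.Solver.Ring ℤ.+-*-rawRing (fromCommutativeRing R) homomorphism ⟦_⟧≟⟦_⟧ public
    using (Polynomial; solve; _:=_; _:+_; _:*_; _:-_; :-_; con)

-- Order and arithmetic in a constructive ordered field.

module OrderedField {c ℓ₁ ℓ₂} (ℝ : RealNumbers c ℓ₁ ℓ₂) where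
  open RealNumbers ℝ
  open IsStrictPartialOrder isStrictPartialOrder
    using (<-respʳ-≈; <-respˡ-≈) renaming (irrefl to <-irrefl; trans to <-trans)
  open IntegerCoefficients commutativeRing

  2# : Carrier
  2# = 1# + 1#

  <⇒# : ∀ {x y} → x < y → x # y
  <⇒# x<y = Equivalence.from (#⇔<⊎> _ _) (inj₁ x<y)

  <⇒≤ : ∀ {x y} → x < y → x ≤ y
  <⇒≤ x<y y<x = <-irrefl refl (<-trans x<y y<x)

  ≤-reflexive : ∀ {x y} → x ≈ y → x ≤ y
  ≤-reflexive x≈y = <-irrefl (sym x≈y)

  ≤-respˡ-≈ : ∀ {x y z} → x ≈ y → x ≤ z → y ≤ z
  ≤-respˡ-≈ x≈y x≤z z<y = x≤z (<-respʳ-≈ (sym x≈y) z<y)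

  ≤-respʳ-≈ : ∀ {x y z} → y ≈ z → x ≤ y → x ≤ z
  ≤-respʳ-≈ y≈z x≤y z<x = x≤y (<-respˡ-≈ (sym y≈z) z<x)

  <-cotrans : ∀ {x y} → x < y → ∀ z → x < z ⊎ z < y
  <-cotrans {x} {y} x<y z with #-cotrans (<⇒# x<y) z
  <-cotrans {x} {y} x<y z | inj₁ x#z with Equivalence.to (#⇔<⊎> x z) x#z
  ... | inj₁ x<z = inj₁ x<z
  ... | inj₂ z<x = inj₂ (<-trans z<x x<y)
  <-cotrans {x} {y} x<y z | inj₂ z#y with Equivalence.to (#⇔<⊎> z y) z#y
  ... | inj₁ z<y = inj₂ z<y
  ... | inj₂ y<z = inj₁ (<-trans x<y y<z)

  ≤-trans : ∀ {x y z} → x ≤ y → y ≤ z → x ≤ z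
  ≤-trans {y = y} x≤y y≤z z<x = [ y≤z , x≤y ]′ (<-cotrans z<x y)

  <-≤-trans : ∀ {x y z} → x < y → y ≤ z → x < z
  <-≤-trans {z = z} x<y y≤z = [ (λ x<z → x<z) , (λ z<y → ⊥-elim (y≤z z<y)) ]′ (<-cotrans x<y z)

  ≤-antisym : ∀ {x y} → x ≤ y → y ≤ x → x ≈ y
  ≤-antisym {x} {y} x≤y y≤x = proj₁ (tight x y)
    λ x#y → [ y≤x , x≤y ]′ (Equivalence.to (#⇔<⊎> x y) x#y)

  +-monoˡ-≤ : ∀ z {x y} → x ≤ y → x + z ≤ y + z
  +-monoˡ-≤ z {x} {y} x≤y y+z<x+z =
    x≤y (<-respˡ-≈ (lemma y z) (<-respʳ-≈ (lemma x z) (+-monoˡ-< (- z) y+z<x+z)))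
    where
    lemma : ∀ a b → (a + b) - b ≈ a
    lemma = solve 2 (λ a b → (a :+ b) :- b := a) refl

  x≤y⇒0≤y-x : ∀ {x y} → x ≤ y → 0# ≤ y - x
  x≤y⇒0≤y-x {x} x≤y = ≤-respˡ-≈ (-‿inverseʳ x) (+-monoˡ-≤ (- x) x≤y)

  -- The usual route to an inequality here: the difference is exhibited as a non-negative
  -- combination of known ones, and a ring identity is left to the solver.
  ≤-certificate : ∀ {x y c} → 0# ≤ c → y - x ≈ c → x ≤ y
  ≤-certificate {x} {y} {c} 0≤c y-x≈c = ≤-respˡ-≈ (+-identityˡ x) (≤-respʳ-≈ c+x≈y (+-monoˡ-≤ x 0≤c))
    where
    c+x≈y : c + x ≈ y
    c+x≈y = trans (+-congʳ (sym y-x≈c)) (solve 2 (λ a b → (b :- a) :+ a := b) refl x y)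

  x<y⇒0<y-x : ∀ {x y} → x < y → 0# < y - x
  x<y⇒0<y-x {x} x<y = <-respˡ-≈ (-‿inverseʳ x) (+-monoˡ-< (- x) x<y)

  x<0⇒0<-x : ∀ {x} → x < 0# → 0# < - x
  x<0⇒0<-x {x} x<0 = <-respʳ-≈ (+-identityˡ (- x)) (x<y⇒0<y-x x<0)

  0<-x⇒x<0 : ∀ {x} → 0# < - x → x < 0#
  0<-x⇒x<0 {x} 0<-x = <-respˡ-≈ (+-identityˡ x) (<-respʳ-≈ (-‿inverseˡ x) (+-monoˡ-< x 0<-x))

  0≤x+y : ∀ {x y} → 0# ≤ x → 0# ≤ y → 0# ≤ x + y
  0≤x+y {x} {y} 0≤x 0≤y = ≤-trans 0≤y (≤-respˡ-≈ (+-identityˡ y) (+-monoˡ-≤ y 0≤x))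

  0≤x∧x#0⇒0<x : ∀ {x} → 0# ≤ x → x # 0# → 0# < x
  0≤x∧x#0⇒0<x {x} 0≤x x#0 = [ (λ x<0 → ⊥-elim (0≤x x<0)) , (λ 0<x → 0<x) ]′ (Equivalence.to (#⇔<⊎> x 0#) x#0)

  invertible⇒#0 : ∀ {x y} → x * y ≈ 1# → x # 0#
  invertible⇒#0 {x} {y} xy≈1 = invertible⇒#
    ( y
    , trans (solve 2 (λ a b → b :* (a :- con (+ 0)) := a :* b) refl x y) xy≈1
    , trans (solve 2 (λ a b → (a :- con (+ 0)) :* b := a :* b) refl x y) xy≈1 )

  -- If `x * y` were negative it would be invertible, hence so would both factors. Being
  -- non-negative and apart from 0 they would be positive, and so would their product.
  0≤x*y : ∀ {x y} → 0# ≤ x → 0# ≤ y → 0# ≤ x * y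
  0≤x*y {x} {y} 0≤x 0≤y xy<0 with #⇒invertible (<⇒# xy<0)
  ... | z , _ , eq = <⇒≤ (*-positive (0≤x∧x#0⇒0<x 0≤x (invertible⇒#0 x[yz]≈1))
                                     (0≤x∧x#0⇒0<x 0≤y (invertible⇒#0 y[xz]≈1))) xy<0
    where
    x[yz]≈1 : x * (y * z) ≈ 1#
    x[yz]≈1 = trans (solve 3 (λ a b d → a :* (b :* d) := (a :* b :- con (+ 0)) :* d) refl x y z) eq
    y[xz]≈1 : y * (x * z) ≈ 1#
    y[xz]≈1 = trans (solve 3 (λ a b d → b :* (a :* d) := (a :* b :- con (+ 0)) :* d) refl x y z) eq

  *-cancelˡ-0≤ : ∀ {x y} → 0# < x → 0# ≤ x * y → 0# ≤ y
  *-cancelˡ-0≤ {x} {y} 0<x 0≤xy y<0 = 0≤xy (0<-x⇒x<0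
    (<-respʳ-≈ (solve 2 (λ a b → a :* (:- b) := :- (a :* b)) refl x y) (*-positive 0<x (x<0⇒0<-x y<0))))

  *-cancelˡ-≤ : ∀ {x y z} → 0# < x → x * y ≤ x * z → y ≤ z
  *-cancelˡ-≤ {x} {y} {z} 0<x xy≤xz = ≤-certificate
    (*-cancelˡ-0≤ 0<x (≤-respʳ-≈ (solve 3 (λ a b d → a :* d :- a :* b := a :* (d :- b)) refl x y z)
                                 (x≤y⇒0≤y-x xy≤xz)))
    refl

  inverse-positive : ∀ {x y} → 0# < x → x * y ≈ 1# → 0# < y
  inverse-positive {x} {y} 0<x xy≈1 = 0≤x∧x#0⇒0<x
    (*-cancelˡ-0≤ 0<x (≤-respʳ-≈ (sym xy≈1) (<⇒≤ 0<1)))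
    (invertible⇒#0 (trans (*-comm y x) xy≈1))

  ∣x∣≤y : ∀ {x y} → x ≤ y → - x ≤ y → ∣ x ∣ ≤ y
  ∣x∣≤y {x} {y} = proj₂ (proj₂ (⊔-supremum x (- x))) y

  x≤∣x∣ : ∀ x → x ≤ ∣ x ∣
  x≤∣x∣ x = proj₁ (⊔-supremum x (- x))

  0<fromℕ : ∀ n → .{{NonZero n}} → 0# < fromℕ n
  0<fromℕ (suc n) = 0<fromℕ[1+n] n

  0≤fromℕ : ∀ n → 0# ≤ fromℕ n
  0≤fromℕ zero    = ≤-reflexive refl
  0≤fromℕ (suc n) = <⇒≤ (0<fromℕ[1+n] n)

  open Algebra.Properties.Semiring.Mult (CommutativeRing.semiring commutativeRing)
    using (×-homo-+; ×1-homo-*)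

  fromℕ-+ : ∀ m n → fromℕ (m ℕ.+ n) ≈ fromℕ m + fromℕ n
  fromℕ-+ = ×-homo-+ 1#

  fromℕ-* : ∀ m n → fromℕ (m ℕ.* n) ≈ fromℕ m * fromℕ n
  fromℕ-* = ×1-homo-*

  fromℕ-mono-≤ : ∀ {m n} → m ℕ.≤ n → fromℕ m ≤ fromℕ n
  fromℕ-mono-≤ {m} m≤n with ℕ.m≤n⇒∃[o]m+o≡n m≤n
  ... | o , ≡.refl = ≤-certificate (0≤fromℕ o)
    (trans (+-congʳ (fromℕ-+ m o)) (solve 2 (λ a b → (a :+ b) :- a := b) refl (fromℕ m) (fromℕ o)))

  fromℕ-mono-< : ∀ {m n} → m ℕ.< n → fromℕ m < fromℕ n
  fromℕ-mono-< {m} m<n = <-≤-trans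
    (<-respˡ-≈ (+-identityˡ (fromℕ m)) (+-monoˡ-< (fromℕ m) 0<1)) (fromℕ-mono-≤ m<n)

  fromℕ-cancel-≤ : ∀ {m n} → fromℕ m ≤ fromℕ n → m ℕ.≤ n
  fromℕ-cancel-≤ m≤n = ℕ.≮⇒≥ λ n<m → m≤n (fromℕ-mono-< n<m)

  -- Turns the upper bounds of `_⊔_` into lower bounds of `_⊓_`, which is defined by negation.
  -x≤y⇒-y≤x : ∀ {x y} → - x ≤ y → - y ≤ x
  -x≤y⇒-y≤x {x} {y} -x≤y = ≤-certificate (x≤y⇒0≤y-x -x≤y)
    (solve 2 (λ a b → a :- (:- b) := b :- (:- a)) refl x y)

  minimum≤ : ∀ {k} (x : Vector Carrier (suc k)) i → minimum x ≤ x i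
  minimum≤ {zero}  x zero    = ≤-reflexive refl
  minimum≤ {suc k} x zero    = -x≤y⇒-y≤x (proj₁ (⊔-supremum _ _))
  minimum≤ {suc k} x (suc i) =
    ≤-trans (-x≤y⇒-y≤x (proj₁ (proj₂ (⊔-supremum _ _)))) (minimum≤ (x ∘ suc) i)

  ≤maximum : ∀ {k} (x : Vector Carrier (suc k)) i → x i ≤ maximum x
  ≤maximum {zero}  x zero    = ≤-reflexive refl
  ≤maximum {suc k} x zero    = proj₁ (⊔-supremum _ _)
  ≤maximum {suc k} x (suc i) = ≤-trans (≤maximum (x ∘ suc) i) (proj₁ (proj₂ (⊔-supremum _ _)))

-- Walks and shortest walks.

module Walks (G : ConnectedGraph) where
  open ConnectedGraph G

  infixr 5 _++_
  _++_ : ∀ {u v w m n} → Walk u v m → Walk v w n → Walk u w (m ℕ.+ n)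
  []      ++ q = q
  (e ∷ p) ++ q = e ∷ (p ++ q)

  reverse : ∀ {u v n} → Walk u v n → Walk v u n
  reverse []                = []
  reverse (_∷_ {n = n} e p) = ≡.subst (Walk _ _) (ℕ.+-comm n 1) (reverse p ++ (~-sym e ∷ []))

  vertex : ∀ {u v n} → Walk u v n → Fin (suc n) → V
  vertex {u} p       zero    = u
  vertex     (e ∷ p) (suc i) = vertex p i

  take : ∀ {u v n} (p : Walk u v n) i → Walk u (vertex p i) (toℕ i)
  take p       zero    = []
  take (e ∷ p) (suc i) = e ∷ take p i

  drop : ∀ {u v n} (p : Walk u v n) i → Walk (vertex p i) v (n ∸ toℕ i)
  drop p       zero    = p
  drop (e ∷ p) (suc i) = drop p i

  Shortest : ∀ {u v n} → Walk u v n → Set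
  Shortest {u} {v} {n} _ = ∀ {m} → Walk u v m → n ℕ.≤ m

  -- If a vertex recurred, cutting out the closed walk between its two visits would shorten the
  -- walk.
  vertices-distinct : ∀ {u v n} (p : Walk u v n) → Shortest p →
                      ∀ {i j} → i Fin.< j → vertex p i ≢ vertex p j
  vertices-distinct {u} {v} {n} p short {i} {j} i<j eq = ℕ.<⇒≱
    (ℕ.<-≤-trans (ℕ.+-monoˡ-< (n ∸ toℕ j) i<j) (ℕ.≤-reflexive (ℕ.m+[n∸m]≡n (ℕ.≤-pred (Fin.toℕ<n j)))))
    (short (≡.subst (λ x → Walk u x (toℕ i)) eq (take p i) ++ drop p j))

  vertex-injective : ∀ {u v n} (p : Walk u v n) → Shortest p →
                     ∀ {i j} → vertex p i ≡ vertex p j → i ≡ j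
  vertex-injective p short {i} {j} eq with Fin.<-cmp i j
  ... | tri< i<j _ _ = ⊥-elim (vertices-distinct p short i<j eq)
  ... | tri≈ _ i≡j _ = i≡j
  ... | tri> _ _ j<i = ⊥-elim (vertices-distinct p short j<i (≡.sym eq))

-- Distinctness of the vertices of a hair, and walks that avoid it.

module Hairs (G : ConnectedGraph)
  (k : ℕ) (W : ℕ → ConnectedGraph.V G)
  (edge : ∀ {i} → i ℕ.< k → ConnectedGraph._~_ G (W (suc i)) (W i))
  (neighbour : ∀ {i} → i ℕ.< k → ∀ {v} → ConnectedGraph._~_ G (W (suc i)) v →
               v ≡ W i ⊎ (suc i ℕ.< k × v ≡ W (suc (suc i))))
  (nonbacktracking : ∀ {i} → suc i ℕ.< k → W i ≢ W (suc (suc i)))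
  where
  open ConnectedGraph G
  open Walks G

  private
    W[i]≢W[1+i] : ∀ {i} → i ℕ.< k → W i ≢ W (suc i)
    W[i]≢W[1+i] i<k eq = ~-irrefl (≡.sym eq) (edge i<k)

    -- If the hair reads the same forwards from i as backwards from 2 + j, then
    -- it backtracks in the middle.
    no-palindrome : ∀ n {i j} → j ≡ n ℕ.+ i → suc j ℕ.< k →
                    W i ≡ W (suc (suc j)) → W (suc i) ≡ W (suc j) → ⊥
    no-palindrome zero          ≡.refl 1+j<k eq eq′ = nonbacktracking 1+j<k eq
    no-palindrome (suc zero)    ≡.refl 1+j<k eq eq′ = W[i]≢W[1+i] (ℕ.<-trans (ℕ.n<1+n _) 1+j<k) eq′
    no-palindrome (suc (suc n)) {i} {j} ≡.refl 1+j<k eq eq′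
      with 1+i<k ← ℕ.≤-<-trans (s≤s (ℕ.m≤n+m i (suc (suc n)))) 1+j<k
      with neighbour (ℕ.<-trans (ℕ.n<1+n _) 1+j<k) (≡.subst (_~ W (suc (suc i))) eq′ (~-sym (edge 1+i<k)))
    ... | inj₁ eq″       = no-palindrome n (≡.sym (ℕ.+-suc n i)) (ℕ.<-trans (ℕ.n<1+n _) 1+j<k) eq′ eq″
    ... | inj₂ (_ , eq″) = nonbacktracking 1+i<k (≡.trans eq (≡.sym eq″))

    -- `W i` and `W (suc (suc i))` are distinct neighbours of the common vertex, so they are `W j`
    -- and `W (suc (suc j))` in some order. In reverse order the hair would contain a palindrome. In
    -- the same order the repetition moves one place towards the end of the hair, `n` steps away,
    -- where the last vertex has no second neighbour.
    W[1+i]≢W[1+j] : ∀ n {i j} → i ℕ.< j → n ℕ.+ suc j ≡ k → W (suc i) ≢ W (suc j)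
    W[1+i]≢W[1+j] n {i} {j} i<j n+1+j≡k eq
      with 1+j≤k ← ℕ.≤-trans (ℕ.m≤n+m (suc j) n) (ℕ.≤-reflexive n+1+j≡k)
      with 1+i<k ← ℕ.≤-trans (s≤s i<j) 1+j≤k
      with neighbour 1+j≤k (≡.subst (_~ W i) eq (edge (ℕ.<-trans i<j 1+j≤k)))
         | neighbour 1+j≤k (≡.subst (_~ W (suc (suc i))) eq (~-sym (edge 1+i<k)))
    ... | inj₁ p           | inj₁ q       = nonbacktracking 1+i<k (≡.trans p (≡.sym q))
    ... | inj₂ (_ , p)     | inj₂ (_ , q) = nonbacktracking 1+i<k (≡.trans p (≡.sym q))
    ... | inj₂ (1+j<k , p) | inj₁ q       =
      no-palindrome (j ∸ i) (≡.sym (ℕ.m∸n+n≡m (ℕ.<⇒≤ i<j))) 1+j<k p eq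
    W[1+i]≢W[1+j] zero    i<j n+1+j≡k eq | inj₁ p | inj₂ (1+j<k , q) = ℕ.<-irrefl n+1+j≡k 1+j<k
    W[1+i]≢W[1+j] (suc n) i<j n+1+j≡k eq | inj₁ p | inj₂ (1+j<k , q) =
      W[1+i]≢W[1+j] n (s≤s i<j) (≡.trans (ℕ.+-suc n _) n+1+j≡k) q

    W[i]≢W[j] : ∀ {i j} → i ℕ.< j → j ℕ.≤ k → W i ≢ W j
    W[i]≢W[j] {suc i} {suc j} (s≤s i<j) j≤k = W[1+i]≢W[1+j] (k ∸ suc j) i<j (ℕ.m∸n+n≡m j≤k)
    W[i]≢W[j] {zero}  {suc zero}        _ j≤k eq = W[i]≢W[1+i] j≤k eq
    -- `W 0` may have neighbours off the hair, so `W 1` is located among the neighbours of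
    -- `W (suc j)` instead.
    W[i]≢W[j] {zero}  {suc j@(suc j-1)} _ j≤k eq
      with neighbour j≤k (≡.subst (_~ W 1) eq (~-sym (edge (ℕ.≤-trans (s≤s z≤n) j≤k))))
    ... | inj₁ p = no-palindrome j-1 (≡.sym (ℕ.+-identityʳ j-1)) j≤k eq p
    ... | inj₂ (1+j<k , p) = W[1+i]≢W[1+j] (k ∸ suc (suc j)) (s≤s z≤n) (ℕ.m∸n+n≡m 1+j<k) p

  W-injective : ∀ {i j} → i ℕ.≤ k → j ℕ.≤ k → W i ≡ W j → i ≡ j
  W-injective {i} {j} i≤k j≤k eq with ℕ.<-cmp i j
  ... | tri< i<j _ _ = ⊥-elim (W[i]≢W[j] i<j j≤k eq)
  ... | tri≈ _ i≡j _ = i≡j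
  ... | tri> _ _ j<i = ⊥-elim (W[i]≢W[j] j<i i≤k (≡.sym eq))

  Outside : V → Set
  Outside v = ∀ {i} → i ℕ.< k → v ≢ W (suc i)

  private
    -- Apart from `W 0`, every hair vertex has all its neighbours on the hair, so a walk to an
    -- outside vertex must reach `W 0`. The rest of the walk from there is returned.
    exit : ∀ {i v n} → i ℕ.< k → Outside v → Walk (W (suc i)) v n → ∃ λ m → m ℕ.< n × Walk (W 0) v m
    exit i<k out [] = ⊥-elim (out i<k ≡.refl)
    exit i<k out (e ∷ p) with neighbour i<k e
    exit {zero}  i<k out (e ∷ p) | inj₁ ≡.refl = _ , ℕ.n<1+n _ , p
    exit {suc i} i<k out (e ∷ p) | inj₁ ≡.refl with exit (ℕ.<-trans (ℕ.n<1+n i) i<k) out p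
    ... | m , m<n , q = m , ℕ.m<n⇒m<1+n m<n , q
    exit i<k out (e ∷ p) | inj₂ (1+i<k , ≡.refl) with exit 1+i<k out p
    ... | m , m<n , q = m , ℕ.m<n⇒m<1+n m<n , q

  -- A visit would enter and leave through `W 0`. Joining the two outer pieces at `W 0` gives a
  -- strictly shorter walk.
  shortest-avoids-hair : ∀ {u v n} (p : Walk u v n) → Shortest p → Outside u → Outside v →
                         ∀ j → Outside (vertex p j)
  shortest-avoids-hair {u} {v} {n} p short u-out v-out j {i} i<k eq
    with exit i<k v-out (≡.subst (λ x → Walk x v _) eq (drop p j))
       | exit i<k u-out (reverse (≡.subst (λ x → Walk u x _) eq (take p j)))
  ... | b , b< , q | a , a< , r = ℕ.<⇒≱
    (ℕ.<-≤-trans (ℕ.+-mono-< a< b<) (ℕ.≤-reflexive (ℕ.m+[n∸m]≡n (ℕ.≤-pred (Fin.toℕ<n j)))))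
    (short (reverse r ++ q))

  -- The vertices `W 1`, ..., `W k` and the `d u v + 1` vertices of a shortest walk are pairwise
  -- distinct, so together they embed in `V`.
  k+d<order : ∀ {u v} → Outside u → Outside v → k ℕ.+ d u v ℕ.< order
  k+d<order {u} {v} u-out v-out with shortestWalk u v
  ... | n , p , short = ≡.subst (ℕ._≤ order) (ℕ.+-suc k n) (Fin.injective⇒≤ {f = f} f-injective)
    where
    g : Fin k ⊎ Fin (suc n) → V
    g (inj₁ i) = W (suc (toℕ i))
    g (inj₂ j) = vertex p j

    f : Fin (k ℕ.+ suc n) → V
    f = g ∘ splitAt k

    g-injective : ∀ {x y} → g x ≡ g y → x ≡ y
    g-injective {inj₁ i} {inj₁ i′} eq = ≡.cong inj₁
      (Fin.toℕ-injective (ℕ.suc-injective (W-injective (Fin.toℕ<n i) (Fin.toℕ<n i′) eq)))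
    g-injective {inj₁ i} {inj₂ j}  eq =
      ⊥-elim (shortest-avoids-hair p short u-out v-out j (Fin.toℕ<n i) (≡.sym eq))
    g-injective {inj₂ j} {inj₁ i}  eq =
      ⊥-elim (shortest-avoids-hair p short u-out v-out j (Fin.toℕ<n i) eq)
    g-injective {inj₂ j} {inj₂ j′} eq = ≡.cong inj₂ (vertex-injective p short eq)

    f-injective : ∀ {x y} → f x ≡ f y → x ≡ y
    f-injective {x} {y} eq = ≡.trans (≡.sym (Fin.join-splitAt k (suc n) x))
      (≡.trans (≡.cong (join k (suc n)) (g-injective {splitAt k x} {splitAt k y} eq)) (Fin.join-splitAt k (suc n) y))

  W₀-outside : Outside (W 0)
  W₀-outside i<k eq with W-injective z≤n i<k eq
  ... | ()

-- Finite sums and characteristic functions.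

module Sums {c ℓ₁ ℓ₂} (ℝ : RealNumbers c ℓ₁ ℓ₂) where
  open RealNumbers ℝ
  open OrderedField ℝ
  open IntegerCoefficients commutativeRing
  open Relation.Binary.Reasoning.Setoid (CommutativeRing.setoid commutativeRing)
  open Algebra.Properties.CommutativeMonoid.Sum (CommutativeRing.+-commutativeMonoid commutativeRing) public
    using (sum-cong-≋; ∑-distrib-+; ∑-comm; sum-replicate; sum-replicate-zero)
  open Algebra.Properties.Semiring.Sum (CommutativeRing.semiring commutativeRing) public
    using (*-distribˡ-sum; *-distribʳ-sum)
  open Algebra.Properties.Semiring.Mult (CommutativeRing.semiring commutativeRing)
    using (×-assoc-*; ×-congʳ)

  sum-const : ∀ n x → sum {n} (λ _ → x) ≈ fromℕ n * x
  sum-const n x = begin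
    sum {n} (λ _ → x)  ≈⟨ sum-replicate n ⟩
    n · x              ≈⟨ ×-congʳ n (*-identityˡ x) ⟨
    n · (1# * x)       ≈⟨ ×-assoc-* n 1# x ⟨
    fromℕ n * x        ∎

  sum-supported : ∀ {n} (f : Vector Carrier n) i → (∀ j → j ≢ i → f j ≈ 0#) → sum f ≈ f i
  sum-supported {suc n} f zero    f≈0 = begin
    f zero + sum (f ∘ suc)       ≈⟨ +-congˡ (sum-cong-≋ λ j → f≈0 (suc j) λ ()) ⟩
    f zero + sum {n} (λ _ → 0#)  ≈⟨ +-congˡ (sum-replicate-zero n) ⟩
    f zero + 0#                  ≈⟨ +-identityʳ _ ⟩
    f zero                       ∎
  sum-supported {suc n} f (suc i) f≈0 = begin
    f zero + sum (f ∘ suc)       ≈⟨ +-cong (f≈0 zero λ ()) (sum-supported (f ∘ suc) i λ j j≢i → f≈0 (suc j) (j≢i ∘ Fin.suc-injective)) ⟩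
    0# + f (suc i)               ≈⟨ +-identityˡ _ ⟩
    f (suc i)                    ∎

  -- Doubled to avoid division. Splitting off the first term leaves the same progression started at
  -- `x + y`.
  sum-arithmetic : ∀ m x y → 2# * sum {suc m} (λ i → x + fromℕ (toℕ i) * y) ≈ fromℕ (suc m) * (2# * x + fromℕ m * y)
  sum-arithmetic zero    x y = solve 2 (λ x y →
    con (+ 2) :* ((x :+ con (+ 0) :* y) :+ con (+ 0)) :=
    (con (+ 1) :+ con (+ 0)) :* (con (+ 2) :* x :+ con (+ 0) :* y)) refl x y
  sum-arithmetic (suc m) x y = begin
    2# * ((x + 0# * y) + sum {suc m} (λ i → x + (1# + fromℕ (toℕ i)) * y))
      ≈⟨ *-congˡ (+-congˡ (sum-cong-≋ {suc m} λ i → solve 3 (λ x y z → x :+ (con (+ 1) :+ z) :* y := (x :+ y) :+ z :* y) refl x y (fromℕ (toℕ i)))) ⟩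
    2# * ((x + 0# * y) + sum {suc m} (λ i → (x + y) + fromℕ (toℕ i) * y))
      ≈⟨ solve 3 (λ x y z → con (+ 2) :* ((x :+ con (+ 0) :* y) :+ z) := con (+ 2) :* x :+ con (+ 2) :* z) refl x y _ ⟩
    2# * x + 2# * sum {suc m} (λ i → (x + y) + fromℕ (toℕ i) * y)
      ≈⟨ +-congˡ (sum-arithmetic m (x + y) y) ⟩
    2# * x + fromℕ (suc m) * (2# * (x + y) + fromℕ m * y)
      ≈⟨ solve 3 (λ x y m → con (+ 2) :* x :+ (con (+ 1) :+ m) :* (con (+ 2) :* (x :+ y) :+ m :* y) :=
           (con (+ 1) :+ (con (+ 1) :+ m)) :* (con (+ 2) :* x :+ (con (+ 1) :+ m) :* y)) refl x y (fromℕ m) ⟩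
    fromℕ (suc (suc m)) * (2# * x + fromℕ (suc m) * y) ∎

  δ : ∀ {n} → Fin n → Vector Carrier n
  δ i j with i Fin.≟ j
  ... | yes _ = 1#
  ... | no  _ = 0#

  δ-≡ : ∀ {n} (i : Fin n) → δ i i ≈ 1#
  δ-≡ i with i Fin.≟ i
  ... | yes _   = refl
  ... | no  i≢i = ⊥-elim (i≢i ≡.refl)

  δ-≢ : ∀ {n} {i j : Fin n} → i ≢ j → δ i j ≈ 0#
  δ-≢ {i = i} {j} i≢j with i Fin.≟ j
  ... | yes i≡j = ⊥-elim (i≢j i≡j)
  ... | no  _   = refl

  -- Counts preimages under `g`, hence is the characteristic function of the image when `g` is
  -- injective. In this form a sum weighted by it needs only an exchange of summation.
  indicator : ∀ {m n} → (Fin m → Fin n) → Vector Carrier n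
  indicator g i = sum (λ j → δ (g j) i)

  sum-indicator : ∀ {m n} (g : Fin m → Fin n) (f : Vector Carrier n) →
                  sum (λ i → indicator g i * f i) ≈ sum (f ∘ g)
  sum-indicator g f = begin
    sum (λ i → sum (λ j → δ (g j) i) * f i)    ≈⟨ sum-cong-≋ (λ i → *-distribʳ-sum (f i) (λ j → δ (g j) i)) ⟩
    sum (λ i → sum (λ j → δ (g j) i * f i))    ≈⟨ ∑-comm (λ i j → δ (g j) i * f i) ⟩
    sum (λ j → sum (λ i → δ (g j) i * f i))    ≈⟨ sum-cong-≋ (λ j → sum-supported _ (g j) (λ i i≢gj → trans (*-congʳ (δ-≢ (i≢gj ∘ ≡.sym))) (zeroˡ _))) ⟩
    sum (λ j → δ (g j) (g j) * f (g j))        ≈⟨ sum-cong-≋ (λ j → trans (*-congʳ (δ-≡ (g j))) (*-identityˡ _)) ⟩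
    sum (f ∘ g)                                ∎

  indicator-∈ : ∀ {m n} (g : Fin m → Fin n) → (∀ {i j} → g i ≡ g j → i ≡ j) →
                ∀ j → indicator g (g j) ≈ 1#
  indicator-∈ g g-injective j = trans
    (sum-supported _ j (λ i i≢j → δ-≢ (i≢j ∘ g-injective))) (δ-≡ (g j))

  indicator-∉ : ∀ {m n} (g : Fin m → Fin n) {i} → (∀ j → g j ≢ i) → indicator g i ≈ 0#
  indicator-∉ {m} g i∉g = trans (sum-cong-≋ (λ j → δ-≢ (i∉g j))) (sum-replicate-zero m)

-- Change of the variance under a shift on a set of vertices.

module Perturbations {c ℓ₁ ℓ₂} (ℝ : RealNumbers c ℓ₁ ℓ₂) (G : ConnectedGraph) where
  open RealNumbers ℝ
  open OrderedField ℝ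
  open Sums ℝ
  open IntegerCoefficients commutativeRing
  open Relation.Binary.Reasoning.Setoid (CommutativeRing.setoid commutativeRing)
  open ConnectedGraph G
  open Variance ℝ G
  open Walks G

  lipschitz⇒difference≤d : ∀ {X} → Lipschitz X → ∀ u v → X u - X v ≤ fromℕ (d u v)
  lipschitz⇒difference≤d lip u v = ≤-trans (x≤∣x∣ _) (lip u v)

  lipschitz⇒difference≤1 : ∀ {X} → Lipschitz X → ∀ {u v} → u ~ v → X u - X v ≤ 1#
  lipschitz⇒difference≤1 lip {u} {v} u~v = ≤-trans (lipschitz⇒difference≤d lip u v)
    (≤-respʳ-≈ (+-identityʳ 1#) (fromℕ-mono-≤ (proj₂ (proj₂ (shortestWalk u v)) (u~v ∷ []))))

  -- The steps telescope along a shortest walk; the reversed walk bounds the negated difference.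
  difference≤1⇒lipschitz : ∀ {X} → (∀ {u v} → u ~ v → X u - X v ≤ 1#) → Lipschitz X
  difference≤1⇒lipschitz {X} step u v with shortestWalk u v
  ... | n , p , _ = ∣x∣≤y (along p)
    (≤-respˡ-≈ (solve 2 (λ x y → y :- x := :- (x :- y)) refl (X u) (X v)) (along (reverse p)))
    where
    along : ∀ {u v n} → Walk u v n → X u - X v ≤ fromℕ n
    along {u} []               = ≤-reflexive (-‿inverseʳ (X u))
    along {u} {w} (_∷_ {v = v} {n = n} e p) = ≤-certificate
      (0≤x+y (x≤y⇒0≤y-x (step e)) (x≤y⇒0≤y-x (along p)))
      (solve 4 (λ x y z n → (con (+ 1) :+ n) :- (x :- z) := (con (+ 1) :- (x :- y)) :+ (n :- (y :- z)))
        refl (X u) (X v) (X w) (fromℕ n))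

  n̂ r : Carrier
  n̂ = fromℕ order
  r = 1/ order

  n̂*r≈1 : n̂ * r ≈ 1#
  n̂*r≈1 = trans (solve 2 (λ a b → a :* b := (a :- con (+ 0)) :* b) refl n̂ r)
    (proj₂ (proj₂ (#⇒invertible (fromℕ#0 order))))

  0<r : 0# < r
  0<r = inverse-positive (0<fromℕ order) n̂*r≈1

  module _ (X : V → Carrier) where
    private
      μ = 𝔼 X
      x : V → Carrier
      x v = X v - μ

    sum-centred : sum x ≈ 0#
    sum-centred = begin
      sum x                          ≈⟨ ∑-distrib-+ X (λ _ → - μ) ⟩
      sum X + sum {order} (λ _ → - μ) ≈⟨ +-congˡ (sum-const order (- μ)) ⟩
      sum X + n̂ * - (r * sum X)      ≈⟨ solve 3 (λ n r s → s :+ n :* (:- (r :* s)) := s :- (n :* r) :* s) refl n̂ r (sum X) ⟩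
      sum X - (n̂ * r) * sum X        ≈⟨ +-congˡ (-‿cong (*-congʳ n̂*r≈1)) ⟩
      sum X - 1# * sum X             ≈⟨ solve 1 (λ s → s :- con (+ 1) :* s := con (+ 0)) refl (sum X) ⟩
      0#                             ∎

    module _ (χ : V → Carrier) (χ-idempotent : ∀ v → χ v * χ v ≈ χ v) (t : Carrier) where
      private
        Y : V → Carrier
        Y v = X v + t * χ v
        M S h Q : Carrier
        M = sum χ
        S = sum (λ v → χ v * x v)
        h = r * (t * M)
        Q = sum (λ v → x v * x v)

        𝔼Y : 𝔼 Y ≈ μ + h
        𝔼Y = begin
          r * sum Y                          ≈⟨ *-congˡ (∑-distrib-+ X _) ⟩
          r * (sum X + sum (λ v → t * χ v))  ≈⟨ *-congˡ (+-congˡ (*-distribˡ-sum t χ)) ⟨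
          r * (sum X + t * M)                ≈⟨ distribˡ r _ _ ⟩
          μ + h                              ∎

        -- `h` is the shift of the mean. Idempotence of `χ` makes the square linear in `χ`, so that
        -- summation produces only `Q`, `S`, `M` and the sum of `x`.
        pointwise : ∀ v → (Y v - 𝔼 Y) * (Y v - 𝔼 Y) ≈
          x v * x v + ((2# * t) * (χ v * x v) + ((t * t - 2# * t * h) * χ v + ((- (2# * h)) * x v + h * h)))
        pointwise v = begin
          (Y v - 𝔼 Y) * (Y v - 𝔼 Y)
            ≈⟨ *-cong (+-congˡ (-‿cong 𝔼Y)) (+-congˡ (-‿cong 𝔼Y)) ⟩
          (Y v - (μ + h)) * (Y v - (μ + h))
            ≈⟨ solve 5 (λ X μ t χ h → let x = X :- μ; y = (X :+ t :* χ) :- (μ :+ h); two = con (+ 2) in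
                 y :* y := x :* x :+ ((two :* t) :* (χ :* x) :+ ((t :* t :* (χ :* χ) :- two :* t :* h :* χ) :+ ((:- (two :* h)) :* x :+ h :* h))))
               refl (X v) μ t (χ v) h ⟩
          x v * x v + ((2# * t) * (χ v * x v) + ((t * t * (χ v * χ v) - 2# * t * h * χ v) + ((- (2# * h)) * x v + h * h)))
            ≈⟨ +-congˡ (+-congˡ (+-congʳ (trans (+-congʳ (*-congˡ (χ-idempotent v)))
                 (solve 3 (λ a b χ → a :* χ :- b :* χ := (a :- b) :* χ) refl (t * t) (2# * t * h) (χ v))))) ⟩
          x v * x v + ((2# * t) * (χ v * x v) + ((t * t - 2# * t * h) * χ v + ((- (2# * h)) * x v + h * h))) ∎

        -- This is `order` times the change of the variance from `X` to `Y`.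
        gain : Carrier
        gain = 2# * t * S + ((t * t - 2# * t * h) * M + n̂ * (h * h))

        sum-pointwise : sum (λ v → (Y v - 𝔼 Y) * (Y v - 𝔼 Y)) ≈ Q + gain
        sum-pointwise = begin
          sum (λ v → (Y v - 𝔼 Y) * (Y v - 𝔼 Y))
            ≈⟨ sum-cong-≋ pointwise ⟩
          sum (λ v → x v * x v + ((2# * t) * (χ v * x v) + ((t * t - 2# * t * h) * χ v + ((- (2# * h)) * x v + h * h))))
            ≈⟨ ∑-distrib-+ (λ v → x v * x v) _ ⟩
          Q + sum (λ v → (2# * t) * (χ v * x v) + ((t * t - 2# * t * h) * χ v + ((- (2# * h)) * x v + h * h)))
            ≈⟨ +-congˡ (∑-distrib-+ (λ v → (2# * t) * (χ v * x v)) _) ⟩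
          Q + (sum (λ v → (2# * t) * (χ v * x v)) + sum (λ v → (t * t - 2# * t * h) * χ v + ((- (2# * h)) * x v + h * h)))
            ≈⟨ +-congˡ (+-cong (sym (*-distribˡ-sum (2# * t) (λ v → χ v * x v))) (∑-distrib-+ (λ v → (t * t - 2# * t * h) * χ v) _)) ⟩
          Q + (2# * t * S + (sum (λ v → (t * t - 2# * t * h) * χ v) + sum (λ v → (- (2# * h)) * x v + h * h)))
            ≈⟨ +-congˡ (+-congˡ (+-cong (sym (*-distribˡ-sum (t * t - 2# * t * h) χ)) (∑-distrib-+ (λ v → (- (2# * h)) * x v) _))) ⟩
          Q + (2# * t * S + ((t * t - 2# * t * h) * M + (sum (λ v → (- (2# * h)) * x v) + sum {order} (λ v → h * h))))
            -- The term linear in `x` drops out because `x` is centred.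
            ≈⟨ +-congˡ (+-congˡ (+-congˡ (+-cong (trans (sym (*-distribˡ-sum (- (2# * h)) x)) (trans (*-congˡ sum-centred) (zeroʳ _))) (sum-const order (h * h))))) ⟩
          Q + (2# * t * S + ((t * t - 2# * t * h) * M + (0# + n̂ * (h * h))))
            ≈⟨ +-congˡ (+-congˡ (+-congˡ (+-identityˡ _))) ⟩
          Q + gain ∎

      -- Optimality makes `gain` at most 0. After multiplication by `n̂`, with `n̂ * h` replaced by
      -- `t * M`, the terms in `h` contribute exactly minus the right-hand side.
      perturbation-bound : VarianceOptimal X → Lipschitz Y →
        n̂ * (2# * t * S + t * t * M) ≤ (t * M) * (t * M)
      perturbation-bound (_ , c² , (_ , max) , VarX≈c²) Y-lip = ≤-certificate
        (0≤x*y (0≤fromℕ order) 0≤-gain)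
        (sym (begin
          n̂ * (- gain)
            ≈⟨ solve 5 (λ n t h S M → let two = con (+ 2) in
                 n :* (:- (two :* t :* S :+ ((t :* t :- two :* t :* h) :* M :+ n :* (h :* h)))) :=
                 (two :* (n :* h) :* (t :* M) :- (n :* h) :* (n :* h)) :- n :* (two :* t :* S :+ t :* t :* M))
               refl n̂ t h S M ⟩
          (2# * (n̂ * h) * (t * M) - (n̂ * h) * (n̂ * h)) - n̂ * (2# * t * S + t * t * M)
            ≈⟨ +-congʳ (+-cong (*-congʳ (*-congˡ n̂h≈tM)) (-‿cong (*-cong n̂h≈tM n̂h≈tM))) ⟩
          (2# * (t * M) * (t * M) - (t * M) * (t * M)) - n̂ * (2# * t * S + t * t * M)
            ≈⟨ +-congʳ (solve 1 (λ a → con (+ 2) :* a :* a :- a :* a := a :* a) refl (t * M)) ⟩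
          (t * M) * (t * M) - n̂ * (2# * t * S + t * t * M) ∎))
        where
        n̂h≈tM : n̂ * h ≈ t * M
        n̂h≈tM = trans (sym (*-assoc n̂ r (t * M))) (trans (*-congʳ n̂*r≈1) (*-identityˡ _))
        0≤-gain : 0# ≤ - gain
        0≤-gain = ≤-respʳ-≈ (solve 2 (λ a b → a :- (a :+ b) := :- b) refl Q gain)
          (x≤y⇒0≤y-x (≤-respˡ-≈ sum-pointwise
            (*-cancelˡ-≤ 0<r (≤-respʳ-≈ (sym VarX≈c²) (max Y Y-lip)))))

-- The two contradictions in natural number arithmetic.

module _ where
  open ℕ.≤-Reasoning
  open +-*-Solver

  runs-length : ∀ p a b → suc p ℕ.+ (suc a ℕ.+ suc b) ≡ 2 ℕ.+ (suc p ℕ.+ a) ℕ.+ b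
  runs-length = solve 3 (λ p a b → con 1 :+ p :+ (con 1 :+ a :+ (con 1 :+ b)) := con 2 :+ (con 1 :+ p :+ a) :+ b) ≡.refl

  -- The last two runs have lengths D = `suc a` and r = `suc b`. The second and third hypotheses
  -- give D < r, whence 4D < 2(D + r) < 2n, against the first.
  no-three-runs-ℕ : ∀ n a b → n ℕ.* 2 ℕ.≤ 4 ℕ.* suc a →
    n ℕ.* (a ℕ.+ 2) ℕ.≤ 2 ℕ.* suc a ℕ.+ 2 ℕ.* suc b ℕ.+ n ℕ.* b → suc a ℕ.+ suc b ℕ.< n → ⊥
  no-three-runs-ℕ n a b 2n≤4D n[a+2]≤ D+r<n = ℕ.<⇒≱ 4D<2n 2n≤4D
    where
    n[a+2]<n[b+2] : n ℕ.* (a ℕ.+ 2) ℕ.< n ℕ.* (b ℕ.+ 2)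
    n[a+2]<n[b+2] = begin-strict
      n ℕ.* (a ℕ.+ 2)                                ≤⟨ n[a+2]≤ ⟩
      2 ℕ.* suc a ℕ.+ 2 ℕ.* suc b ℕ.+ n ℕ.* b        ≡⟨ ≡.cong (ℕ._+ n ℕ.* b) (ℕ.*-distribˡ-+ 2 (suc a) (suc b)) ⟨
      2 ℕ.* (suc a ℕ.+ suc b) ℕ.+ n ℕ.* b            <⟨ ℕ.+-monoˡ-< (n ℕ.* b) (ℕ.*-monoʳ-< 2 D+r<n) ⟩
      2 ℕ.* n ℕ.+ n ℕ.* b                            ≡⟨ solve 2 (λ n b → con 2 :* n :+ n :* b := n :* (b :+ con 2)) ≡.refl n b ⟩
      n ℕ.* (b ℕ.+ 2)                                ∎
    a<b : a ℕ.< b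
    a<b = ℕ.+-cancelʳ-< 2 a b (ℕ.*-cancelˡ-< n _ _ n[a+2]<n[b+2])
    4D<2n : 4 ℕ.* suc a ℕ.< n ℕ.* 2
    4D<2n = begin-strict
      4 ℕ.* suc a              ≡⟨ solve 1 (λ D → con 4 :* D := (D :+ D) :* con 2) ≡.refl (suc a) ⟩
      (suc a ℕ.+ suc a) ℕ.* 2  <⟨ ℕ.*-monoˡ-< 2 (ℕ.<-trans (ℕ.+-monoʳ-< (suc a) (s≤s a<b)) D+r<n) ⟩
      n ℕ.* 2                  ∎

  -- With b = `suc a`, the last two hypotheses yield n ≥ 2b and n ≥ b + 2. Hence 3n ≥ 4b + 4, which
  -- exceeds the bound 4b + 2.
  no-two-runs-ℕ : ∀ n a d → n ℕ.* 3 ℕ.≤ 2 ℕ.* (suc a ℕ.+ suc (suc a)) → suc a ℕ.≤ d ℕ.+ 2 →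
    2 ℕ.+ a ℕ.+ d ℕ.< n → ⊥
  no-two-runs-ℕ n a d 3n≤ 1+a≤d+2 2+a+d<n = ℕ.<⇒≱ <3n 3n≤
    where
    2+2a≤n : 2 ℕ.+ 2 ℕ.* a ℕ.≤ n
    2+2a≤n = begin
      2 ℕ.+ 2 ℕ.* a          ≡⟨ solve 1 (λ a → con 2 :+ con 2 :* a := con 1 :+ a :+ (con 1 :+ a)) ≡.refl a ⟩
      1 ℕ.+ a ℕ.+ (1 ℕ.+ a)  ≤⟨ ℕ.+-monoʳ-≤ (1 ℕ.+ a) 1+a≤d+2 ⟩
      1 ℕ.+ a ℕ.+ (d ℕ.+ 2)  ≡⟨ solve 2 (λ a d → con 1 :+ a :+ (d :+ con 2) := con 1 :+ (con 2 :+ a :+ d)) ≡.refl a d ⟩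
      1 ℕ.+ (2 ℕ.+ a ℕ.+ d)  ≤⟨ 2+a+d<n ⟩
      n                      ∎
    3+a≤n : 3 ℕ.+ a ℕ.≤ n
    3+a≤n = ℕ.≤-trans (s≤s (s≤s (s≤s (ℕ.m≤m+n a d)))) 2+a+d<n
    <3n : 2 ℕ.* (suc a ℕ.+ suc (suc a)) ℕ.< n ℕ.* 3
    <3n = begin-strict
      2 ℕ.* (suc a ℕ.+ suc (suc a))                    <⟨ s≤s (ℕ.n≤1+n _) ⟩
      2 ℕ.+ 2 ℕ.* (suc a ℕ.+ suc (suc a))              ≡⟨ solve 1 (λ a → con 2 :+ con 2 :* (con 1 :+ a :+ (con 2 :+ a)) := con 2 :+ con 2 :* a :+ con 2 :* (con 3 :+ a)) ≡.refl a ⟩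
      2 ℕ.+ 2 ℕ.* a ℕ.+ 2 ℕ.* (3 ℕ.+ a)                ≤⟨ ℕ.+-mono-≤ 2+2a≤n (ℕ.*-monoʳ-≤ 2 3+a≤n) ⟩
      n ℕ.+ 2 ℕ.* n                                    ≡⟨ solve 1 (λ n → n :+ con 2 :* n := n :* con 3) ≡.refl n ⟩
      n ℕ.* 3                                          ∎

-- Variance-optimal functions along a hair.

module OptimalOnHair {c ℓ₁ ℓ₂} (ℝ : RealNumbers c ℓ₁ ℓ₂) (G : ConnectedGraph)
  (X : ConnectedGraph.V G → RealNumbers.Carrier ℝ)
  (X-optimal : Variance.VarianceOptimal ℝ G X)
  (k : ℕ) (W : ℕ → ConnectedGraph.V G)
  (edge : ∀ {i} → i ℕ.< k → ConnectedGraph._~_ G (W (suc i)) (W i))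
  (neighbour : ∀ {i} → i ℕ.< k → ∀ {v} → ConnectedGraph._~_ G (W (suc i)) v →
               v ≡ W i ⊎ (suc i ℕ.< k × v ≡ W (suc (suc i))))
  (nonbacktracking : ∀ {i} → suc i ℕ.< k → W i ≢ W (suc (suc i)))
  where
  open RealNumbers ℝ
  open OrderedField ℝ
  open Sums ℝ
  open IntegerCoefficients commutativeRing
  open IsStrictPartialOrder isStrictPartialOrder
    using (<-respʳ-≈; <-respˡ-≈) renaming (trans to <-trans)
  open Relation.Binary.Reasoning.Setoid (CommutativeRing.setoid commutativeRing)
  open ConnectedGraph G
  open Variance ℝ G
  open Perturbations ℝ G
  open Hairs G k W edge neighbour nonbacktracking

  X-lipschitz : Lipschitz X
  X-lipschitz = proj₁ X-optimal

  μ : Carrier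
  μ = 𝔼 X

  diff : ℕ → Carrier
  diff i = X (W (suc i)) - X (W i)

  Bounded : Carrier → Set _
  Bounded x = x ≤ 1# × - x ≤ 1#

  Bounded-resp-≈ : ∀ {x y} → x ≈ y → Bounded x → Bounded y
  Bounded-resp-≈ x≈y (x≤1 , -x≤1) = ≤-respˡ-≈ x≈y x≤1 , ≤-respˡ-≈ (-‿cong x≈y) -x≤1

  Bounded-neg : ∀ {x} → Bounded x → Bounded (- x)
  Bounded-neg {x} (x≤1 , -x≤1) = -x≤1 , ≤-respˡ-≈ (solve 1 (λ x → x := :- (:- x)) refl x) x≤1

  0<2# : 0# < 2#
  0<2# = <-trans 0<1 (<-respˡ-≈ (+-identityˡ 1#) (+-monoˡ-< 1# 0<1))

  Bounded-1 : Bounded 1#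
  Bounded-1 = ≤-reflexive refl , ≤-certificate (<⇒≤ 0<2#)
    (solve 0 (con (+ 1) :- (:- con (+ 1)) := con (+ 2)) refl)

  diff-bounded : ∀ {i} → i ℕ.< k → Bounded (diff i)
  diff-bounded {i} i<k = lipschitz⇒difference≤1 X-lipschitz (edge i<k) ,
    ≤-respˡ-≈ (solve 2 (λ x y → y :- x := :- (x :- y)) refl _ _) (lipschitz⇒difference≤1 X-lipschitz (~-sym (edge i<k)))

  -- The segment has the `suc m` vertices from `W (suc i)` on. Edge `i` enters it; an edge leaving
  -- it exists only if the segment stops before the end of the hair, hence the guard on `right`.
  module Interval (i m : ℕ) (i+m<k : i ℕ.+ m ℕ.< k) (t : Carrier)
    (left  : Bounded (diff i + t))
    (right : suc (i ℕ.+ m) ℕ.< k → Bounded (diff (suc (i ℕ.+ m)) - t))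
    where

    g : Fin (suc m) → V
    g s = W (suc (i ℕ.+ toℕ s))

    index<k : ∀ (s : Fin (suc m)) → i ℕ.+ toℕ s ℕ.< k
    index<k s = ℕ.≤-<-trans (ℕ.+-monoʳ-≤ i (ℕ.≤-pred (Fin.toℕ<n s))) i+m<k

    g-injective : ∀ {s s′} → g s ≡ g s′ → s ≡ s′
    g-injective {s} {s′} eq = Fin.toℕ-injective
      (ℕ.+-cancelˡ-≡ i _ _ (ℕ.suc-injective (W-injective (index<k s) (index<k s′) eq)))

    χ : V → Carrier
    χ = indicator g

    χ-in : ∀ {v} → (∃ λ s → g s ≡ v) → χ v ≈ 1#
    χ-in (s , ≡.refl) = indicator-∈ g g-injective s

    χ-out : ∀ {v} → ¬ (∃ λ s → g s ≡ v) → χ v ≈ 0#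
    χ-out v∉ = indicator-∉ g (λ s gs≡v → v∉ (s , gs≡v))

    member? : ∀ v → Dec (∃ λ s → g s ≡ v)
    member? v = Fin.any? (λ s → g s Fin.≟ v)

    χ-idempotent : ∀ v → χ v * χ v ≈ χ v
    χ-idempotent v with member? v
    ... | yes v∈ = trans (*-congʳ (χ-in v∈)) (*-identityˡ _)
    ... | no  v∉ = trans (*-congʳ (χ-out v∉)) (trans (zeroˡ _) (sym (χ-out v∉)))

    -- By `neighbour` the edge belongs to the hair, and every hair edge at the segment other than
    -- the two at its ends leads back into it.
    boundary : ∀ {u v} → (∃ λ s → g s ≡ u) → ¬ (∃ λ s → g s ≡ v) → u ~ v → Bounded ((X u - X v) + t)
    boundary (s , ≡.refl) v∉ u~v with neighbour (index<k s) u~v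
    boundary (zero , ≡.refl) v∉ u~v | inj₁ ≡.refl rewrite ℕ.+-identityʳ i = left
    boundary (suc s , ≡.refl) v∉ u~v | inj₁ ≡.refl =
      ⊥-elim (v∉ (Fin.inject₁ s , ≡.trans (≡.cong (λ a → W (suc (i ℕ.+ a))) (Fin.toℕ-inject₁ s)) (≡.cong W (≡.sym (ℕ.+-suc i (toℕ s))))))
    boundary (s , ≡.refl) v∉ u~v | inj₂ (<k , ≡.refl) with ℕ.m≤n⇒m<n∨m≡n (ℕ.≤-pred (Fin.toℕ<n s))
    ... | inj₁ s<m = ⊥-elim (v∉ (Fin.fromℕ< (s≤s s<m) ,
      ≡.trans (≡.cong (λ a → W (suc (i ℕ.+ a))) (Fin.toℕ-fromℕ< (s≤s s<m))) (≡.cong (W ∘ suc) (ℕ.+-suc i (toℕ s)))))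
    ... | inj₂ s≡m rewrite s≡m = Bounded-resp-≈
      (solve 3 (λ x y t → :- ((x :- y) :- t) := (y :- x) :+ t) refl _ _ t)
      (Bounded-neg (right <k))

    Y : V → Carrier
    Y v = X v + t * χ v

    Y-lipschitz : Lipschitz Y
    Y-lipschitz = difference≤1⇒lipschitz step
      where
      Y-difference : ∀ {u v a b} → χ u ≈ a → χ v ≈ b → (X u - X v) + t * (a - b) ≈ Y u - Y v
      Y-difference {u} {v} χu χv = trans (+-congˡ (*-congˡ (+-cong (sym χu) (-‿cong (sym χv)))))
        (solve 5 (λ x y t a b → (x :- y) :+ t :* (a :- b) := (x :+ t :* a) :- (y :+ t :* b)) refl (X u) (X v) t (χ u) (χ v))

      step : ∀ {u v} → u ~ v → Y u - Y v ≤ 1#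
      step {u} {v} u~v with member? u | member? v
      ... | yes u∈ | yes v∈ = ≤-respˡ-≈
        (trans (solve 3 (λ x y t → x :- y := (x :- y) :+ t :* (con (+ 1) :- con (+ 1))) refl (X u) (X v) t) (Y-difference (χ-in u∈) (χ-in v∈)))
        (lipschitz⇒difference≤1 X-lipschitz u~v)
      ... | no u∉ | no v∉ = ≤-respˡ-≈
        (trans (solve 3 (λ x y t → x :- y := (x :- y) :+ t :* (con (+ 0) :- con (+ 0))) refl (X u) (X v) t) (Y-difference (χ-out u∉) (χ-out v∉)))
        (lipschitz⇒difference≤1 X-lipschitz u~v)
      ... | yes u∈ | no v∉ = ≤-respˡ-≈
        (trans (solve 3 (λ x y t → (x :- y) :+ t := (x :- y) :+ t :* (con (+ 1) :- con (+ 0))) refl (X u) (X v) t) (Y-difference (χ-in u∈) (χ-out v∉)))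
        (proj₁ (boundary u∈ v∉ u~v))
      ... | no u∉ | yes v∈ = ≤-respˡ-≈
        (trans (solve 3 (λ x y t → :- ((y :- x) :+ t) := (x :- y) :+ t :* (con (+ 0) :- con (+ 1))) refl (X u) (X v) t) (Y-difference (χ-out u∉) (χ-in v∈)))
        (proj₂ (boundary v∈ u∉ (~-sym u~v)))

    M S : Carrier
    M = fromℕ (suc m)
    S = sum (λ s → X (g s) - μ)

    interval-bound : n̂ * (2# * t * S + t * t * M) ≤ (t * M) * (t * M)
    interval-bound = ≤-respˡ-≈ (*-congˡ (+-cong (*-congˡ (sum-indicator g _)) (*-congˡ sum-χ)))
      (≤-respʳ-≈ (*-cong (*-congˡ sum-χ) (*-congˡ sum-χ))
        (perturbation-bound X χ χ-idempotent t X-optimal Y-lipschitz))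
      where
      sum-χ : sum χ ≈ M
      sum-χ = begin
        sum χ                       ≈⟨ sum-cong-≋ (λ v → sym (*-identityʳ (χ v))) ⟩
        sum (λ v → χ v * 1#)        ≈⟨ sum-indicator g (λ _ → 1#) ⟩
        sum {suc m} (λ _ → 1#)      ≈⟨ sum-const (suc m) 1# ⟩
        M * 1#                      ≈⟨ *-identityʳ M ⟩
        M                           ∎

  -- The degenerate case of `k+d<order` with both vertices equal to `W 0`.
  k<order : k ℕ.< order
  k<order = ℕ.≤-<-trans (ℕ.m≤m+n k _) (k+d<order W₀-outside W₀-outside)

  -- Moving the tail beyond edge i by t changes the variance by a strictly convex
  -- function of t, so the difference along the edge cannot lie strictly inside
  -- its range [-1, 1].
  diff-extreme : ∀ {i} → i ℕ.< k → - 1# < diff i → diff i < 1# → ⊥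
  diff-extreme {i} i<k -1<e e<1 = 0≤-2c -2c<0
    where
    m = k ∸ suc i
    1+i+m≡k : suc (i ℕ.+ m) ≡ k
    1+i+m≡k = ℕ.m+[n∸m]≡n i<k
    e a b M : Carrier
    e = diff i
    a = 1# - e
    b = 1# + e
    M = fromℕ (suc m)
    0<a : 0# < a
    0<a = x<y⇒0<y-x e<1
    0<b : 0# < b
    0<b = <-respʳ-≈ (solve 1 (λ e → e :- (:- con (+ 1)) := con (+ 1) :+ e) refl e) (x<y⇒0<y-x -1<e)
    beyond : ∀ {ℓ} {A : Set ℓ} → suc (i ℕ.+ m) ℕ.< k → A
    beyond <k = ⊥-elim (ℕ.<-irrefl 1+i+m≡k <k)
    -- The shifts by `a` and `- b` bring the step to 1 and -1. With the positive factors `a` and `b`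
    -- cancelled, their bounds read `A + cc * a` ≤ 0 ≤ `A - cc * b`. As `a + b` is 2, `cc` is at
    -- most 0, although M < n̂ makes it positive.
    module I₁ = Interval i m (ℕ.≤-reflexive 1+i+m≡k) a
      (Bounded-resp-≈ (solve 1 (λ e → con (+ 1) := e :+ (con (+ 1) :- e)) refl e) Bounded-1) beyond
    module I₂ = Interval i m (ℕ.≤-reflexive 1+i+m≡k) (- b)
      (Bounded-resp-≈ (solve 1 (λ e → :- con (+ 1) := e :+ (:- (con (+ 1) :+ e))) refl e) (Bounded-neg Bounded-1)) beyond
    cc A : Carrier
    cc = M * (n̂ - M)
    A = n̂ * (2# * I₁.S)
    p₁ : 0# ≤ - (A + cc * a)
    p₁ = *-cancelˡ-0≤ 0<a (≤-respʳ-≈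
      (solve 4 (λ a n S M → (a :* M) :* (a :* M) :- n :* (con (+ 2) :* a :* S :+ a :* a :* M)
         := a :* (:- (n :* (con (+ 2) :* S) :+ (M :* (n :- M)) :* a))) refl a n̂ I₁.S M)
      (x≤y⇒0≤y-x I₁.interval-bound))
    p₂ : 0# ≤ A - cc * b
    p₂ = *-cancelˡ-0≤ 0<b (≤-respʳ-≈
      (solve 4 (λ b n S M → ((:- b) :* M) :* ((:- b) :* M) :- n :* (con (+ 2) :* (:- b) :* S :+ (:- b) :* (:- b) :* M)
         := b :* (n :* (con (+ 2) :* S) :- (M :* (n :- M)) :* b)) refl b n̂ I₁.S M)
      (x≤y⇒0≤y-x I₂.interval-bound))
    0≤-2c : 0# ≤ - (cc * 2#)
    0≤-2c = ≤-respʳ-≈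
      (solve 3 (λ A c e → (:- (A :+ c :* (con (+ 1) :- e))) :+ (A :- c :* (con (+ 1) :+ e)) := :- (c :* con (+ 2))) refl A cc e)
      (0≤x+y p₁ p₂)
    1+m<order : suc m ℕ.< order
    1+m<order = ℕ.≤-<-trans (ℕ.≤-trans (s≤s (ℕ.m≤n+m m i)) (ℕ.≤-reflexive 1+i+m≡k)) k<order
    -2c<0 : - (cc * 2#) < 0#
    -2c<0 = 0<-x⇒x<0 (<-respʳ-≈ (solve 1 (λ x → x := :- (:- x)) refl _)
      (*-positive (*-positive (0<fromℕ[1+n] m) (x<y⇒0<y-x (fromℕ-mono-< 1+m<order))) 0<2#))

  ⟨_⟩ : Sign → Carrier
  ⟨ Sign.+ ⟩ = 1#
  ⟨ Sign.- ⟩ = - 1#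

  ⟨⟩-opposite : ∀ σ → ⟨ opposite σ ⟩ ≈ - ⟨ σ ⟩
  ⟨⟩-opposite Sign.+ = refl
  ⟨⟩-opposite Sign.- = solve 0 (con (+ 1) := :- (:- con (+ 1))) refl

  ⟨⟩-square : ∀ σ → ⟨ σ ⟩ * ⟨ σ ⟩ ≈ 1#
  ⟨⟩-square Sign.+ = *-identityˡ 1#
  ⟨⟩-square Sign.- = solve 0 ((:- con (+ 1)) :* (:- con (+ 1)) := con (+ 1)) refl

  ⟨⟩-bounded : ∀ σ → Bounded ⟨ σ ⟩
  ⟨⟩-bounded Sign.+ = Bounded-1
  ⟨⟩-bounded Sign.- = Bounded-neg Bounded-1

  -1<1 : - 1# < 1#
  -1<1 = <-trans (0<-x⇒x<0 (<-respʳ-≈ (solve 0 (con (+ 1) := :- (:- con (+ 1))) refl) 0<1)) 0<1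

  -- Once one bound is strict, `diff-extreme` refutes strictness of the other. Since `_≤_` is a
  -- negated `_<_`, antisymmetry then fixes the value.
  diff-sign : ∀ {i} → i ℕ.< k → ∃ λ σ → diff i ≈ ⟨ σ ⟩
  diff-sign {i} i<k with <-cotrans -1<1 (diff i)
  ... | inj₁ -1<e = Sign.+ , ≤-antisym (proj₁ (diff-bounded i<k)) (diff-extreme i<k -1<e)
  ... | inj₂ e<1  = Sign.- , ≤-antisym (λ -1<e → diff-extreme i<k -1<e e<1)
    (≤-certificate (x≤y⇒0≤y-x (proj₂ (diff-bounded i<k)))
      (solve 1 (λ e → e :- (:- con (+ 1)) := con (+ 1) :- (:- e)) refl (diff i)))

  -- The direction of the step from W i to W (suc i), and + for i ≥ k.
  ε : ℕ → Sign
  ε i with i ℕ.<? k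
  ... | yes i<k = proj₁ (diff-sign i<k)
  ... | no  _   = Sign.+

  diff≈⟨ε⟩ : ∀ {i} → i ℕ.< k → diff i ≈ ⟨ ε i ⟩
  diff≈⟨ε⟩ {i} i<k with i ℕ.<? k
  ... | yes p   = proj₂ (diff-sign p)
  ... | no  i≮k = ⊥-elim (i≮k i<k)

  constant-slope : ∀ {η} i m → (∀ {j} → j ℕ.< m → diff (i ℕ.+ j) ≈ η) →
                   X (W (i ℕ.+ m)) ≈ X (W i) + fromℕ m * η
  constant-slope {η} i zero slope = trans (reflexive (≡.cong (X ∘ W) (ℕ.+-identityʳ i)))
    (solve 2 (λ x y → x := x :+ con (+ 0) :* y) refl (X (W i)) η)
  constant-slope {η} i (suc m) slope = begin
    X (W (i ℕ.+ suc m))                  ≡⟨ ≡.cong (X ∘ W) (ℕ.+-suc i m) ⟩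
    X (W (suc (i ℕ.+ m)))                ≈⟨ solve 2 (λ x y → x := y :+ (x :- y)) refl _ _ ⟩
    X (W (i ℕ.+ m)) + diff (i ℕ.+ m)     ≈⟨ +-cong (constant-slope i m (λ j<m → slope (ℕ.m<n⇒m<1+n j<m))) (slope (ℕ.n<1+n m)) ⟩
    (X (W i) + fromℕ m * η) + η          ≈⟨ solve 3 (λ x m y → (x :+ m :* y) :+ y := x :+ (con (+ 1) :+ m) :* y) refl _ _ η ⟩
    X (W i) + fromℕ (suc m) * η          ∎

  -- The shift by 2 σ reverses the steps at both ends of the segment
  -- W (suc i), …, W (suc i + m).
  segment-bound : ∀ i m σ {η} → i ℕ.+ m ℕ.< k →
    diff i ≈ - ⟨ σ ⟩ → (∀ {j} → j ℕ.< m → diff (suc i ℕ.+ j) ≈ η) →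
    (suc (i ℕ.+ m) ℕ.< k → diff (suc (i ℕ.+ m)) ≈ ⟨ σ ⟩) →
    n̂ * (⟨ σ ⟩ * (2# * (X (W (suc i)) - μ) + fromℕ m * η) + 2#) ≤ 2# * fromℕ (suc m)
  -- At `t = 2# * s` both sides of the interval bound contain the factor `2# * M`, which is
  -- cancelled.
  segment-bound i m σ {η} i+m<k left slope right = *-cancelˡ-≤ (*-positive 0<2# (0<fromℕ[1+n] m))
    (≤-certificate (x≤y⇒0≤y-x interval-bound) (sym (begin
      (t * M) * (t * M) - n̂ * (2# * t * S + t * t * M)
        ≈⟨ solve 4 (λ s n S M → let two = con (+ 2); t = two :* s in
             (t :* M) :* (t :* M) :- n :* (two :* t :* S :+ t :* t :* M) :=
             (s :* s) :* (con (+ 4) :* M :* M :- con (+ 4) :* n :* M) :- n :* (two :* s :* (two :* S))) refl s n̂ S M ⟩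
      (s * s) * ((2# + 1# + 1#) * M * M - (2# + 1# + 1#) * n̂ * M) - n̂ * (2# * s * (2# * S))
        ≈⟨ +-cong (*-congʳ (⟨⟩-square σ)) (-‿cong (*-congˡ (*-congˡ 2S≈MC))) ⟩
      1# * ((2# + 1# + 1#) * M * M - (2# + 1# + 1#) * n̂ * M) - n̂ * (2# * s * (M * C))
        ≈⟨ solve 4 (λ s n C M → let two = con (+ 2) in
             con (+ 1) :* (con (+ 4) :* M :* M :- con (+ 4) :* n :* M) :- n :* (two :* s :* (M :* C)) :=
             (two :* M) :* (two :* M) :- (two :* M) :* (n :* (s :* C :+ two))) refl s n̂ C M ⟩
      (2# * M) * (2# * M) - (2# * M) * (n̂ * (s * C + 2#)) ∎)))
    where
    s t C : Carrier
    s = ⟨ σ ⟩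
    t = 2# * s
    -- Twice the average of `X - μ` over the segment: the first and last terms of an arithmetic
    -- progression added up.
    C = 2# * (X (W (suc i)) - μ) + fromℕ m * η
    open Interval i m i+m<k t
      (Bounded-resp-≈ (sym (trans (+-congʳ left) (solve 1 (λ s → (:- s) :+ con (+ 2) :* s := s) refl s))) (⟨⟩-bounded σ))
      (λ <k → Bounded-resp-≈ (sym (trans (+-congʳ (right <k)) (solve 1 (λ s → s :- con (+ 2) :* s := :- s) refl s))) (Bounded-neg (⟨⟩-bounded σ)))
    2S≈MC : 2# * S ≈ M * C
    2S≈MC = begin
      2# * S
        ≈⟨ *-congˡ (sum-cong-≋ {suc m} λ j → trans
             (+-congʳ (constant-slope (suc i) (toℕ j) (λ j′<j → slope (ℕ.<-≤-trans j′<j (ℕ.≤-pred (Fin.toℕ<n j))))))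
             (solve 3 (λ x y μ → (x :+ y) :- μ := (x :- μ) :+ y) refl _ _ μ)) ⟩
      2# * sum {suc m} (λ j → (X (W (suc i)) - μ) + fromℕ (toℕ j) * η)
        ≈⟨ sum-arithmetic m _ η ⟩
      M * C ∎

  -- `W (suc p)` is the turning vertex. The product `s * u` is its height above the mean measured in
  -- direction `τ`, which treats peaks and valleys at once.
  module Turn (p : ℕ) (1+p<k : suc p ℕ.< k) (τ : Sign)
    (rise : diff p ≈ ⟨ τ ⟩) (fall : diff (suc p) ≈ - ⟨ τ ⟩) where

    s u : Carrier
    s = ⟨ τ ⟩
    u = X (W (suc p)) - μ

    rise′ : diff p ≈ - ⟨ opposite τ ⟩
    rise′ = trans rise (trans (solve 1 (λ s → s := :- (:- s)) refl s) (-‿cong (sym (⟨⟩-opposite τ))))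

    -- The segment starts at the turning vertex and is shifted by -2τ, so it has to stop where the
    -- run in direction -τ goes on or the hair ends.
    bound-from-turn : ∀ a → p ℕ.+ a ℕ.< k → (∀ {j} → j ℕ.< a → diff (suc p ℕ.+ j) ≈ - s) →
      (suc (p ℕ.+ a) ℕ.< k → diff (suc (p ℕ.+ a)) ≈ - s) →
      n̂ * (fromℕ a + 2# - 2# * (s * u)) ≤ 2# * fromℕ (suc a)
    bound-from-turn a p+a<k slope right = ≤-respˡ-≈ (*-congˡ (begin
      ⟨ opposite τ ⟩ * (2# * u + fromℕ a * - s) + 2#
        ≈⟨ +-congʳ (*-congʳ (⟨⟩-opposite τ)) ⟩
      - s * (2# * u + fromℕ a * - s) + 2#
        ≈⟨ solve 3 (λ s u a → (:- s) :* (con (+ 2) :* u :+ a :* (:- s)) :+ con (+ 2) :=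
             a :* (s :* s) :+ con (+ 2) :- con (+ 2) :* (s :* u)) refl s u (fromℕ a) ⟩
      fromℕ a * (s * s) + 2# - 2# * (s * u)
        ≈⟨ +-congʳ (+-congʳ (trans (*-congˡ (⟨⟩-square τ)) (*-identityʳ _))) ⟩
      fromℕ a + 2# - 2# * (s * u) ∎))
      (segment-bound p a (opposite τ) p+a<k rise′ slope (λ <k → trans (right <k) (sym (⟨⟩-opposite τ))))

    -- The segment starts one vertex past the turn and is shifted by 2τ, so it has to stop at the
    -- next turn or at the end of the hair. The unknown `s * u` has the sign opposite to that in
    -- `bound-from-turn`, so it cancels on addition.
    bound-after-turn : ∀ a → suc p ℕ.+ a ℕ.< k → (∀ {j} → j ℕ.< a → diff (suc (suc p) ℕ.+ j) ≈ - s) →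
      (suc (suc p ℕ.+ a) ℕ.< k → diff (suc (suc p ℕ.+ a)) ≈ s) →
      n̂ * (2# * (s * u) - fromℕ a) ≤ 2# * fromℕ (suc a)
    bound-after-turn a 1+p+a<k slope right = ≤-respˡ-≈ (*-congˡ (begin
      s * (2# * (X (W (suc (suc p))) - μ) + fromℕ a * - s) + 2#
        ≈⟨ +-congʳ (*-congˡ (+-congʳ (*-congˡ (trans
             (solve 3 (λ y x μ → y :- μ := (x :- μ) :+ (y :- x)) refl _ (X (W (suc p))) μ) (+-congˡ fall))))) ⟩
      s * (2# * (u - s) + fromℕ a * - s) + 2#
        ≈⟨ solve 3 (λ s u a → s :* (con (+ 2) :* (u :- s) :+ a :* (:- s)) :+ con (+ 2) :=
             con (+ 2) :* (s :* u) :+ con (+ 2) :- (con (+ 2) :+ a) :* (s :* s)) refl s u (fromℕ a) ⟩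
      2# * (s * u) + 2# - (2# + fromℕ a) * (s * s)
        ≈⟨ +-congˡ (-‿cong (*-congˡ (⟨⟩-square τ))) ⟩
      2# * (s * u) + 2# - (2# + fromℕ a) * 1#
        ≈⟨ solve 2 (λ y a → y :+ con (+ 2) :- (con (+ 2) :+ a) :* con (+ 1) := y :- a) refl _ (fromℕ a) ⟩
      2# * (s * u) - fromℕ a ∎))
      (segment-bound (suc p) a τ 1+p+a<k fall slope right)

  private
    -- con (+ n) denotes a sum bracketed differently from fromℕ n.
    numeral : ∀ {m} → ℕ → Polynomial m
    numeral zero    = con (+ 0)
    numeral (suc n) = con (+ 1) :+ numeral n

  no-three-runs : ∀ {p q τ} → p ℕ.< q → suc q ℕ.< k → ε p ≡ τ →
    (∀ {j} → p ℕ.< j → j ℕ.≤ q → ε j ≡ opposite τ) → (∀ {j} → q ℕ.< j → j ℕ.< k → ε j ≡ τ) → ⊥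
  no-three-runs {p} {τ = τ} p<q 1+q<k εp εpq εqk with ℕ.m≤n⇒∃[o]m+o≡n p<q | ℕ.m≤n⇒∃[o]m+o≡n 1+q<k
  -- The last two runs have `suc a` and `suc b` steps.
  ... | a , ≡.refl | b , 2+q+b≡k =
    no-three-runs-ℕ order a b
      -- Adding `A` and `B` eliminates the height `s * u`; so does adding `A` and `C` below.
      (fromℕ-cancel-≤ (≤-certificate (0≤x+y (x≤y⇒0≤y-x A) (x≤y⇒0≤y-x B))
        (trans (+-cong (fromℕ-* 4 (suc a)) (-‿cong (fromℕ-* order 2)))
          (solve 3 (λ n a y → let two = con (+ 2); D = con (+ 1) :+ a in
             numeral 4 :* D :- n :* numeral 2 :=
             (two :* D :- n :* (two :* y :- a)) :+ (two :* D :- n :* (a :+ two :- two :* y)))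
           refl n̂ (fromℕ a) (s * u)))))
      (fromℕ-cancel-≤ (≤-certificate (0≤x+y (x≤y⇒0≤y-x A) (x≤y⇒0≤y-x C))
        (trans (+-cong
          (trans (fromℕ-+ (2 ℕ.* suc a ℕ.+ 2 ℕ.* suc b) (order ℕ.* b))
            (+-cong (trans (fromℕ-+ (2 ℕ.* suc a) (2 ℕ.* suc b)) (+-cong (fromℕ-* 2 (suc a)) (fromℕ-* 2 (suc b)))) (fromℕ-* order b)))
          (-‿cong (trans (fromℕ-* order (a ℕ.+ 2)) (*-congˡ (fromℕ-+ a 2)))))
          (solve 4 (λ n a b y → let two = con (+ 2); D = con (+ 1) :+ a; r = con (+ 1) :+ b in
             numeral 2 :* D :+ numeral 2 :* r :+ n :* b :- n :* (a :+ numeral 2) :=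
             (two :* D :- n :* (two :* y :- a)) :+ (two :* r :- n :* (two :* (D :- y) :- b)))
           refl n̂ (fromℕ a) (fromℕ b) (s * u)))))
      (ℕ.≤-<-trans D+r≤k k<order)
    where
    q : ℕ
    q = suc p ℕ.+ a
    q<k : q ℕ.< k
    q<k = ℕ.<-trans (ℕ.n<1+n q) 1+q<k
    p<k : p ℕ.< k
    p<k = ℕ.<-trans p<q q<k
    D+r≤k : suc a ℕ.+ suc b ℕ.≤ k
    D+r≤k = ℕ.≤-trans (ℕ.m≤n+m _ (suc p)) (ℕ.≤-reflexive (≡.trans
      (runs-length p a b)
      2+q+b≡k))
    fall : ∀ {j} → p ℕ.< j → j ℕ.≤ q → diff j ≈ - ⟨ τ ⟩
    fall p<j j≤q = trans (diff≈⟨ε⟩ (ℕ.≤-<-trans j≤q q<k))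
      (trans (reflexive (≡.cong ⟨_⟩ (εpq p<j j≤q))) (⟨⟩-opposite τ))
    rise : ∀ {j} → q ℕ.< j → j ℕ.< k → diff j ≈ ⟨ τ ⟩
    rise q<j j<k = trans (diff≈⟨ε⟩ j<k) (reflexive (≡.cong ⟨_⟩ (εqk q<j j<k)))
    -opp : - ⟨ opposite τ ⟩ ≈ ⟨ τ ⟩
    -opp = trans (-‿cong (⟨⟩-opposite τ)) (solve 1 (λ s → :- (:- s) := s) refl ⟨ τ ⟩)
    module P = Turn p (ℕ.≤-<-trans p<q q<k) τ (trans (diff≈⟨ε⟩ p<k) (reflexive (≡.cong ⟨_⟩ εp))) (fall (ℕ.n<1+n p) p<q)
    module Q = Turn q 1+q<k (opposite τ) (trans (fall p<q ℕ.≤-refl) (sym (⟨⟩-opposite τ))) (trans (rise (ℕ.n<1+n q) 1+q<k) (sym -opp))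
    s u : Carrier
    s = ⟨ τ ⟩
    u = P.u
    A : n̂ * (2# * (s * u) - fromℕ a) ≤ 2# * fromℕ (suc a)
    A = P.bound-after-turn a q<k
      (λ {j} j<a → fall (s≤s (ℕ.m≤n⇒m≤1+n (ℕ.m≤m+n p j))) (s≤s (ℕ.+-monoʳ-< p j<a)))
      (rise (ℕ.n<1+n q))
    -- The segment stops one vertex before the second turn, so the step leaving it, edge `q`, still
    -- goes in direction -τ.
    B : n̂ * (fromℕ a + 2# - 2# * (s * u)) ≤ 2# * fromℕ (suc a)
    B = P.bound-from-turn a (ℕ.<-trans (ℕ.n<1+n _) q<k)
      (λ {j} j<a → fall (s≤s (ℕ.m≤m+n p j)) (s≤s (ℕ.+-monoʳ-≤ p (ℕ.<⇒≤ j<a))))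
      (λ _ → fall p<q ℕ.≤-refl)
    -- Between the turns `X` moves by `suc a` against `τ`, so the height of the second turn,
    -- measured in its own direction `opposite τ`, is `fromℕ (suc a) - s * u`.
    C : n̂ * (2# * (fromℕ (suc a) - s * u) - fromℕ b) ≤ 2# * fromℕ (suc b)
    C = ≤-respˡ-≈ (*-congˡ (+-congʳ (*-congˡ (begin
      Q.s * Q.u
        ≈⟨ *-cong (⟨⟩-opposite τ) (+-congʳ (trans (reflexive (≡.cong (X ∘ W) (≡.sym (ℕ.+-suc (suc p) a))))
             (constant-slope (suc p) (suc a) (λ {j} j<1+a → fall (s≤s (ℕ.m≤m+n p j)) (s≤s (ℕ.+-monoʳ-≤ p (ℕ.≤-pred j<1+a))))))) ⟩
      - s * ((X (W (suc p)) + fromℕ (suc a) * - s) - μ)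
        ≈⟨ solve 4 (λ s x D μ → (:- s) :* ((x :+ D :* (:- s)) :- μ) := D :* (s :* s) :- s :* (x :- μ)) refl s _ (fromℕ (suc a)) μ ⟩
      fromℕ (suc a) * (s * s) - s * u
        ≈⟨ +-congʳ (trans (*-congˡ (⟨⟩-square τ)) (*-identityʳ _)) ⟩
      fromℕ (suc a) - s * u ∎))))
      (Q.bound-after-turn b (ℕ.≤-reflexive 2+q+b≡k)
        (λ {j} j<b → trans (rise (s≤s (ℕ.m≤n⇒m≤1+n (ℕ.m≤m+n q j))) (ℕ.<-≤-trans (s≤s (s≤s (ℕ.+-monoʳ-< q j<b))) (ℕ.≤-reflexive 2+q+b≡k))) (sym -opp))
        (λ <k → ⊥-elim (ℕ.<-irrefl 2+q+b≡k <k)))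

  no-two-runs : ∀ {u′ u″ p τ} → Outside u′ → Outside u″ →
    (∀ i → X u′ ≤ X (W i) + 1#) → (∀ i → X (W i) - 1# ≤ X u″) →
    suc p ℕ.< k → ε p ≡ τ → (∀ {j} → p ℕ.< j → j ℕ.< k → ε j ≡ opposite τ) → ⊥
  no-two-runs {u′} {u″} {p} {τ} u′-out u″-out u′-low u″-high 1+p<k εp εpk with ℕ.m≤n⇒∃[o]m+o≡n 1+p<k
  ... | a , 2+p+a≡k =
    no-two-runs-ℕ order a (d u″ u′)
      -- `A` shifts the tail just after the turn, `B` the tail including the turning vertex; their
      -- sum is free of `s * u`.
      (fromℕ-cancel-≤ (≤-certificate (0≤x+y (x≤y⇒0≤y-x A) (x≤y⇒0≤y-x B))
        (trans (+-cong (trans (fromℕ-* 2 (suc a ℕ.+ suc (suc a))) (*-congˡ (fromℕ-+ (suc a) (suc (suc a))))) (-‿cong (fromℕ-* order 3)))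
          (solve 3 (λ n a y → let two = con (+ 2); b = con (+ 1) :+ a in
             numeral 2 :* (b :+ (con (+ 1) :+ b)) :- n :* numeral 3 :=
             (two :* b :- n :* (two :* y :- a)) :+ (two :* (con (+ 1) :+ b) :- n :* (b :+ two :- two :* y)))
           refl n̂ (fromℕ a) (s * u)))))
      (fromℕ-cancel-≤ (≤-respʳ-≈ (sym (fromℕ-+ (d u″ u′) 2)) (distance τ ≡.refl)))
      -- The hair has at least `2 + a` edges: the `suc a` edges of the last run, and edge `p`.
      (ℕ.≤-<-trans (ℕ.+-monoˡ-≤ (d u″ u′) (ℕ.≤-trans (s≤s (s≤s (ℕ.m≤n+m a p))) (ℕ.≤-reflexive 2+p+a≡k)))
        (k+d<order u″-out u′-out))
    where
    p<k : p ℕ.< k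
    p<k = ℕ.<-trans (ℕ.n<1+n p) 1+p<k
    fall : ∀ {j} → p ℕ.< j → j ℕ.< k → diff j ≈ - ⟨ τ ⟩
    fall p<j j<k = trans (diff≈⟨ε⟩ j<k) (trans (reflexive (≡.cong ⟨_⟩ (εpk p<j j<k))) (⟨⟩-opposite τ))
    module P = Turn p 1+p<k τ (trans (diff≈⟨ε⟩ p<k) (reflexive (≡.cong ⟨_⟩ εp))) (fall (ℕ.n<1+n p) 1+p<k)
    s u : Carrier
    s = ⟨ τ ⟩
    u = P.u
    1+p+[1+a]≡k : suc p ℕ.+ suc a ≡ k
    1+p+[1+a]≡k = ≡.trans (ℕ.+-suc (suc p) a) 2+p+a≡k
    slope : ∀ {j} → j ℕ.< suc a → diff (suc p ℕ.+ j) ≈ - ⟨ τ ⟩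
    slope {j} j<1+a = fall (s≤s (ℕ.m≤m+n p j)) (ℕ.<-≤-trans (ℕ.+-monoʳ-< (suc p) j<1+a) (ℕ.≤-reflexive 1+p+[1+a]≡k))
    A : n̂ * (2# * (s * u) - fromℕ a) ≤ 2# * fromℕ (suc a)
    A = P.bound-after-turn a (ℕ.≤-reflexive 2+p+a≡k)
      (λ {j} j<a → trans (reflexive (≡.cong diff (≡.sym (ℕ.+-suc (suc p) j)))) (slope (s≤s j<a)))
      (λ <k → ⊥-elim (ℕ.<-irrefl 2+p+a≡k <k))
    B : n̂ * (fromℕ (suc a) + 2# - 2# * (s * u)) ≤ 2# * fromℕ (suc (suc a))
    B = P.bound-from-turn (suc a) (ℕ.≤-reflexive 1+p+[1+a]≡k) slope
      (λ <k → ⊥-elim (ℕ.<-irrefl 1+p+[1+a]≡k <k))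
    last : X (W (suc p ℕ.+ suc a)) ≈ X (W (suc p)) + fromℕ (suc a) * - ⟨ τ ⟩
    last = constant-slope (suc p) (suc a) slope
    u″-u′≤d : X u″ - X u′ ≤ fromℕ (d u″ u′)
    u″-u′≤d = lipschitz⇒difference≤d X-lipschitz u″ u′
    -- Replacing `W i` by `u″` and `W j` by `u′` costs at most 1 each; the Lipschitz bound covers
    -- the rest.
    gap : ∀ i j → X (W i) - X (W j) ≤ fromℕ (d u″ u′) + fromℕ 2
    gap i j = ≤-certificate
      (0≤x+y (0≤x+y (x≤y⇒0≤y-x (u″-high i)) (x≤y⇒0≤y-x (u′-low j))) (x≤y⇒0≤y-x u″-u′≤d))
      (solve 5 (λ x y x′ x″ d → (d :+ numeral 2) :- (x :- y) :=
         (x″ :- (x :- con (+ 1))) :+ ((y :+ con (+ 1)) :- x′) :+ (d :- (x″ :- x′)))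
       refl (X (W i)) (X (W j)) (X u′) (X u″) (fromℕ (d u″ u′)))
    -- The last run changes `X` by `suc a`, down or up according to `τ`, so `gap` is needed in
    -- either order. The equation permits a case split on `τ`, on which the definitions above
    -- already depend.
    distance : ∀ σ → τ ≡ σ → fromℕ (suc a) ≤ fromℕ (d u″ u′) + fromℕ 2
    distance Sign.+ ≡.refl = ≤-respˡ-≈ (trans (+-congˡ (-‿cong last))
      (solve 2 (λ x b → x :- (x :+ b :* (:- con (+ 1))) := b) refl _ (fromℕ (suc a))))
      (gap (suc p) (suc p ℕ.+ suc a))
    distance Sign.- ≡.refl = ≤-respˡ-≈ (trans (+-congʳ last)
      (solve 2 (λ x b → (x :+ b :* (:- (:- con (+ 1)))) :- x := b) refl _ (fromℕ (suc a))))
      (gap (suc p ℕ.+ suc a) (suc p))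

-- The last change in a sequence of signs.

-- The tail is searched first, so `f 0` matters only if the tail is constant. The pattern before `p`
-- is left open; a second application to an initial segment finds the preceding run.
last-change : ∀ (f : ℕ → Sign) n →
  (∃ λ σ → ∀ {i} → i ℕ.< n → f i ≡ σ) ⊎
  (∃ λ p → ∃ λ σ → suc p ℕ.< n × f p ≡ σ × (∀ {i} → p ℕ.< i → i ℕ.< n → f i ≡ opposite σ))
last-change f zero    = inj₁ (Sign.+ , λ ())
last-change f (suc n) with last-change (f ∘ suc) n
... | inj₂ (p , σ , 1+p<n , fp , after) = inj₂ (suc p , σ , s≤s 1+p<n , fp , λ { (s≤s p<i) (s≤s i<n) → after p<i i<n })
-- For the empty tail `Sign.+` is an arbitrary default, so a single entry supplies its own sign.
last-change f (suc zero)    | inj₁ _        = inj₁ (f 0 , λ { (s≤s z≤n) → ≡.refl })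
last-change f (suc (suc n)) | inj₁ (σ , const) with f 0 Sign.≟ σ
... | yes f0≡σ = inj₁ (σ , λ { {zero} _ → f0≡σ ; {suc i} (s≤s i<n) → const i<n })
... | no  f0≢σ = inj₂ (0 , opposite σ , s≤s (s≤s z≤n) , ≢⇒≡opposite f0≢σ ,
  λ { {suc i} _ (s≤s i<n) → ≡.trans (const i<n) (≡.sym (Sign.opposite-involutive σ)) })
  where
  ≢⇒≡opposite : ∀ {s t} → s ≢ t → s ≡ opposite t
  ≢⇒≡opposite {Sign.+} {Sign.+} s≢t = ⊥-elim (s≢t ≡.refl)
  ≢⇒≡opposite {Sign.+} {Sign.-} s≢t = ≡.refl
  ≢⇒≡opposite {Sign.-} {Sign.+} s≢t = ≡.refl
  ≢⇒≡opposite {Sign.-} {Sign.-} s≢t = ⊥-elim (s≢t ≡.refl)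

-- Indexing a hair by natural numbers.

-- Truncation at `k`. It extends `w` to all of ℕ by repeating the last vertex, so that index
-- arithmetic needs no coercions between `Fin` types.
clamp : ∀ {k} → ℕ → Fin (suc k)
clamp {k}     zero    = zero
clamp {zero}  (suc i) = zero
clamp {suc k} (suc i) = suc (clamp i)

clamp-toℕ : ∀ {k} (i : Fin (suc k)) → clamp (toℕ i) ≡ i
clamp-toℕ         zero    = ≡.refl
clamp-toℕ {suc k} (suc i) = ≡.cong suc (clamp-toℕ i)

clamp-inject₁ : ∀ {k} (i : Fin k) → clamp (toℕ i) ≡ inject₁ i
clamp-inject₁ i = ≡.trans (≡.cong clamp (≡.sym (Fin.toℕ-inject₁ i))) (clamp-toℕ (inject₁ i))

module HairVertices (G : ConnectedGraph) (k : ℕ) (w : Vector (ConnectedGraph.V G) (suc k))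
  (hair : ConnectedGraph.IsHair G w) where
  open ConnectedGraph G

  W : ℕ → V
  W = w ∘ clamp

  W-suc : ∀ (i : Fin k) → W (suc (toℕ i)) ≡ w (suc i)
  W-suc i = ≡.cong w (clamp-toℕ (suc i))

  W-inject₁ : ∀ (i : Fin k) → W (toℕ i) ≡ w (inject₁ i)
  W-inject₁ i = ≡.cong w (clamp-inject₁ i)

  inner : ∀ {i} (1+i<k : suc i ℕ.< k) →
    W i ≢ W (2 ℕ.+ i) × (∀ {v} → W (suc i) ~ v → v ≡ W i ⊎ v ≡ W (2 ℕ.+ i)) × W (suc i) ~ W i
  inner {i} 1+i<k = edges (Fin.fromℕ< i<k) (Fin.fromℕ< 1+i<k) (Fin.toℕ-fromℕ< i<k) (Fin.toℕ-fromℕ< 1+i<k)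
    where
    i<k : i ℕ.< k
    i<k = ℕ.<-trans (ℕ.n<1+n i) 1+i<k
    -- The indices are generalised so that `i` can be replaced by `toℕ a`.
    edges : ∀ (a b : Fin k) → toℕ a ≡ i → toℕ b ≡ suc i →
      W i ≢ W (2 ℕ.+ i) × (∀ {v} → W (suc i) ~ v → v ≡ W i ⊎ v ≡ W (2 ℕ.+ i)) × W (suc i) ~ W i
    edges a b ≡.refl b≡1+a with proj₁ hair a b b≡1+a
    ... | distinct , to , from
      rewrite W-inject₁ a | W-suc a | ≡.trans (≡.cong (W ∘ suc) (≡.sym b≡1+a)) (W-suc b) =
      distinct ,
      (λ e → [ inj₁ ∘ ≡.sym , inj₂ ∘ ≡.sym ]′ (to e)) ,
      from (inj₁ ≡.refl)

  end : ∀ {i} → suc i ≡ k → (∀ {v} → W (suc i) ~ v → v ≡ W i) × W (suc i) ~ W i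
  end {i} 1+i≡k = edges (Fin.fromℕ< i<k) (Fin.toℕ-fromℕ< i<k)
    where
    i<k : i ℕ.< k
    i<k = ℕ.≤-reflexive 1+i≡k
    edges : ∀ (a : Fin k) → toℕ a ≡ i → (∀ {v} → W (suc i) ~ v → v ≡ W i) × W (suc i) ~ W i
    edges a ≡.refl with proj₂ hair a 1+i≡k
    ... | to , from rewrite W-inject₁ a | W-suc a = (≡.sym ∘ to) , from ≡.refl

  edge : ∀ {i} → i ℕ.< k → W (suc i) ~ W i
  edge i<k with ℕ.m≤n⇒m<n∨m≡n i<k
  ... | inj₁ 1+i<k = proj₂ (proj₂ (inner 1+i<k))
  ... | inj₂ 1+i≡k = proj₂ (end 1+i≡k)

  neighbour : ∀ {i} → i ℕ.< k → ∀ {v} → W (suc i) ~ v → v ≡ W i ⊎ (suc i ℕ.< k × v ≡ W (2 ℕ.+ i))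
  neighbour i<k e with ℕ.m≤n⇒m<n∨m≡n i<k
  ... | inj₁ 1+i<k = Sum.map₂ (1+i<k ,_) (proj₁ (proj₂ (inner 1+i<k)) e)
  ... | inj₂ 1+i≡k = inj₁ (proj₁ (end 1+i≡k) e)

  nonbacktracking : ∀ {i} → suc i ℕ.< k → W i ≢ W (2 ℕ.+ i)
  nonbacktracking 1+i<k = proj₁ (inner 1+i<k)

-- Both conclusions from the sign pattern of the steps.

lemma2p10 : ∀ {c ℓ₁ ℓ₂} (ℝ : RealNumbers c ℓ₁ ℓ₂) (G : ConnectedGraph) →
    let open RealNumbers ℝ
        open ConnectedGraph G
        open Variance ℝ G in
    ∀ (X : V → Carrier) → VarianceOptimal X →
    ∀ (k : ℕ) → 1 ℕ.≤ k → ∀ (w : Vector V (ℕ.suc k)) → IsHair w →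
    let m = minimum (X ∘ w)
        M = maximum (X ∘ w) in
    Unimodular (X ∘ w)
    × (∀ (u′ u″ : V) → X u′ ≤ m + 1# → M - 1# ≤ X u″ →
       (∀ (i : Fin k) → u′ ≢ w (suc i)) → (∀ (i : Fin k) → u″ ≢ w (suc i)) →
       Monotone (X ∘ w))
lemma2p10 ℝ G X X-optimal k _ w hair = unimodular , monotone
  where
  open RealNumbers ℝ
  open OrderedField ℝ
  open IntegerCoefficients commutativeRing
  open ConnectedGraph G
  open HairVertices G k w hair
  open OptimalOnHair ℝ G X X-optimal k W edge neighbour nonbacktracking
  open Hairs G k W edge neighbour nonbacktracking using (Outside)

  difference≈⟨ε⟩ : ∀ i {σ} → ε (toℕ i) ≡ σ → difference (X ∘ w) i ≈ ⟨ σ ⟩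
  difference≈⟨ε⟩ i ≡.refl = trans
    (reflexive (≡.cong₂ (λ u v → X u - X v) (≡.sym (W-suc i)) (≡.sym (W-inject₁ i))))
    (diff≈⟨ε⟩ (Fin.toℕ<n i))

  unimodular : Unimodular (X ∘ w)
  unimodular with last-change ε k
  -- With ℓ = 0 the second condition covers all steps.
  ... | inj₁ (σ , const) = 0 , z≤n , (λ _ _ ()) , λ j j′ _ _ →
    trans (difference≈⟨ε⟩ j (const (Fin.toℕ<n j))) (sym (difference≈⟨ε⟩ j′ (const (Fin.toℕ<n j′))))
  -- The initial segment ends with edge `q`, the last before the final run; a further change in it
  -- would produce three runs.
  ... | inj₂ (q , σ , 1+q<k , εq , after) with last-change ε (suc q)
  ...   | inj₁ (σ′ , const) = suc q , ℕ.<⇒≤ 1+q<k ,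
    (λ i i′ i≤q i′≤q → trans (difference≈⟨ε⟩ i (const i≤q)) (sym (difference≈⟨ε⟩ i′ (const i′≤q)))) ,
    (λ j j′ q<j q<j′ → trans (difference≈⟨ε⟩ j (after q<j (Fin.toℕ<n j))) (sym (difference≈⟨ε⟩ j′ (after q<j′ (Fin.toℕ<n j′)))))
  ...   | inj₂ (p , τ , 1+p≤q , εp , between) = ⊥-elim (no-three-runs (ℕ.≤-pred 1+p≤q) 1+q<k εp
    (λ p<j j≤q → between p<j (s≤s j≤q))
    (λ q<j j<k → ≡.trans (after q<j j<k) opposite-σ≡τ))
    where
    -- Edge `q` lies in the middle run, so the signs of the three runs alternate.
    opposite-σ≡τ : opposite σ ≡ τ
    opposite-σ≡τ = ≡.trans (≡.cong opposite (≡.trans (≡.sym εq) (between (ℕ.≤-pred 1+p≤q) (ℕ.n<1+n q))))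
      (Sign.opposite-involutive τ)

  monotone : ∀ u′ u″ → X u′ ≤ minimum (X ∘ w) + 1# → maximum (X ∘ w) - 1# ≤ X u″ →
    (∀ i → u′ ≢ w (suc i)) → (∀ i → u″ ≢ w (suc i)) → Monotone (X ∘ w)
  monotone u′ u″ u′-low u″-high u′-out u″-out with last-change ε k
  ... | inj₂ (p , τ , 1+p<k , εp , after) = ⊥-elim (no-two-runs (outside u′-out) (outside u″-out)
    -- The bounds at the minimum and the maximum pass to every vertex of the hair.
    (λ i → ≤-trans u′-low (+-monoˡ-≤ 1# (minimum≤ (X ∘ w) (clamp i))))
    (λ i → ≤-trans (+-monoˡ-≤ (- 1#) (≤maximum (X ∘ w) (clamp i))) u″-high)
    1+p<k εp after)
    where
    outside : ∀ {v} → (∀ i → v ≢ w (suc i)) → Outside v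
    outside out i<k v≡ = out (Fin.fromℕ< i<k)
      (≡.trans v≡ (≡.trans (≡.cong (W ∘ suc) (≡.sym (Fin.toℕ-fromℕ< i<k))) (W-suc (Fin.fromℕ< i<k))))
  ... | inj₁ (σ , const) = direction σ ≡.refl
    where
    travelled : ∀ {i j : Fin (suc k)} → i Fin.≤ j → X (w j) ≈ X (w i) + fromℕ (toℕ j ∸ toℕ i) * ⟨ σ ⟩
    travelled {i} {j} i≤j = trans
      (reflexive (≡.cong (X ∘ w) (≡.trans (≡.sym (clamp-toℕ j)) (≡.cong clamp (≡.sym (ℕ.m+[n∸m]≡n i≤j))))))
      (trans (constant-slope (toℕ i) (toℕ j ∸ toℕ i) (λ {l} l< →
          let <k = ℕ.<-≤-trans (ℕ.+-monoʳ-< (toℕ i) l<) (ℕ.≤-trans (ℕ.≤-reflexive (ℕ.m+[n∸m]≡n i≤j)) (ℕ.≤-pred (Fin.toℕ<n j)))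
          in trans (diff≈⟨ε⟩ <k) (reflexive (≡.cong ⟨_⟩ (const <k)))))
        (+-congʳ (reflexive (≡.cong (X ∘ w) (clamp-toℕ i)))))

    direction : ∀ τ → σ ≡ τ → Monotone (X ∘ w)
    direction Sign.+ ≡.refl = inj₁ λ {i} {j} i≤j → ≤-certificate (0≤fromℕ (toℕ j ∸ toℕ i))
      (trans (+-congʳ (travelled i≤j)) (solve 2 (λ x n → (x :+ n :* con (+ 1)) :- x := n) refl _ _))
    direction Sign.- ≡.refl = inj₂ λ {i} {j} i≤j → ≤-certificate (0≤fromℕ (toℕ j ∸ toℕ i))
      (trans (+-congˡ (-‿cong (travelled i≤j))) (solve 2 (λ x n → x :- (x :+ n :* (:- con (+ 1))) := n) refl _ _))
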